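{- Let $M(0,0)$ be a two counter machine with both registers initialized to $0$, and let $[\![M(0,0)]\!]_2$ be its encoding as a CHR program over a signature with finitely many constant symbols and no function symbols of arity $>0$ (defined in the context). For $k>0$ (respectively $k=0$), $M(0,0)$ halts with output $k$ if and only if the goal $zero(R_1)\wedge zero(R_2)\wedge i(1,R_1,R_2)$ (with $R_1,R_2$ variables) in the program $[\![M(0,0)]\!]_2$ produces a qualified answer $$\exists_{ -R_1,R_2}\Big(i(p_j,SuccR_1^{k},R_2')\wedge zero(R_1)\wedge s(R_1,SuccR_1^1)\wedge\bigwedge_{i=1}^{k-1}s(SuccR_1^{i},SuccR_1^{i+1})\wedge H\Big),$$ where $Fv(H)\cap\{R_1,SuccR_1^1,\ldots,SuccR_1^k\}=\emptyset$ (respectively a qualified answer $\exists_{ -R_1,R_2}(i(p_j,R_1,R_2')\wedge zero(R_1)\wedge H)$, where $Fv(H)\cap\{R_1\}=\emptyset$). Here $SuccR_1^1,\ldots,SuccR_1^k$ are variables.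
   Context: **CHR.** Fix a signature whose predicate symbols are split into two disjoint sets $\Pi_b$ (built-in) and $\Pi_u$ (user-defined), and a first-order theory $CT$ giving the meaning of built-ins. Built-in constraints are given by $c::=a\mid c\wedge c\mid\exists_x c$ with $a$ an atomic formula over $\Pi_b$; a user-defined constraint is an atomic formula over $\Pi_u$. Conjunctions of atomic constraints are treated as multisets; "," denotes conjunction (multiset union); ${\tt true}$ is the empty multiset of built-in constraints. $Fv(\phi)$ is the set of free variables of $\phi$, and $\exists_{ -V}\phi$ is the existential closure of $\phi$ except for the variables in $V$. $p(\bar t)=p(\bar t')$ denotes the componentwise equalities $\bar t=\bar t'$ (undefined for different predicate symbols), extended in the expected way to multisets of constraints. A simplification rule has the form $H\Leftrightarrow C\mid B$ and a propagation rule the form $H\Rightarrow C\mid B$, where the head $H$ is a nonempty multiset of user-defined constraints, the guard $C$ a multiset of built-in constraints (omitted when it is ${\tt true}$), and the body $B$ a multiset of constraints of both kinds. A program is a finite set of rules; a goal is a multiset of constraints of both kinds. Configurations are triples $\langle G,K,d\rangle$ ($G$ the constraints still to be solved, $K$ the accumulated user-defined constraints, $d$ a built-in constraint). For a program $P$, the relation $\longrightarrow$ is the least one such that: - Solve: $\langle (c,G),K,d\rangle\longrightarrow\langle G,K,d'\rangle$ if $c$ is built-in and $CT\models c\wedge d\leftrightarrow d'$; - Introduce: $\langle (h,G),K,d\rangle\longrightarrow\langle G,(h,K),d\rangle$ if $h$ is user-defined; - Simplify: $\langle G,H'\wedge K,d\rangle\longrightarrow\langle B\wedge G,K,H=H'\wedge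 d\rangle$ if $(H\Leftrightarrow C\mid B)\in P$, $x=Fv(H)$ and $CT\models d\rightarrow\exists_x((H=H')\wedge C)$; - Propagate: $\langle G,H'\wedge K,d\rangle\longrightarrow\langle B\wedge G,H'\wedge K,H=H'\wedge d\rangle$ if $(H\Rightarrow C\mid B)\in P$, $x=Fv(H)$ and $CT\models d\rightarrow\exists_x((H=H')\wedge C)$. In Simplify and Propagate the program rule is renamed with fresh variables. The qualified answers of $G$ in $P$ are $$\mathcal{QA}_P(G)=\{\exists_{ -Fv(G)}(K\wedge d)\mid \langle G,\emptyset,\emptyset\rangle\longrightarrow^*\langle\emptyset,K,d\rangle\not\longrightarrow\}.$$ Answers are read up to logical equivalence with respect to built-in constraints (so solved equations may be applied to terms); multiplicity of user-defined constraints matters. In this statement the signature contains finitely many constants (including the instruction numbers) and no function symbols of arity $>0$, there are countably many variables, the user-defined predicates are $i,s,zero$, and $CT$ defines only the symbol $=$, interpreted as pattern matching (syntactic equality), which may not be used in rule bodies. **Two counter machines.** A two counter machine $M(v_0,v_1)$ has two registers $R_1,R_2$ holding natural numbers, initialized with $v_0,v_1$, and a program which is a finite sequence of instructions numbered $1,\dots,n$, of the types: $j:Succ(R_i)$ (add 1 to $R_i$ and go to instruction $j+1$); $j:DecJump(R_i,l)$ (if $R_i$ is not zero, decrease it by 1 and go to $j+1$, otherwise jump to instruction $l$); $j:Halt$ (stop and return the value in $R_1$); here $1\le i\le 2$ and all instruction numbers, including those reached as successors $j+1$, lie in $\{1,\dots,n\}$. The computation starts at instruction $1$; execution stops when the program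 counter reaches a $Halt$ instruction. **Encoding.** $p_i$ denotes the constant for the number of the $i$-th instruction (so $p_1=1$). $[\![M(0,0)]\!]_2$ is the set of all rules obtained from the instructions of $M$ as follows ($R_1,R_2,SuccR_1,SuccR_2,PreR_1,PreR_2$ are variables); $Halt$ instructions give no rule: - $p_i:Succ(r_1)$ gives $i(p_i,R_1,R_2)\Leftrightarrow s(R_1,SuccR_1),\,i(p_{i+1},SuccR_1,R_2)$; - $p_i:Succ(r_2)$ gives $i(p_i,R_1,R_2)\Leftrightarrow s(R_2,SuccR_2),\,i(p_{i+1},R_1,SuccR_2)$; - $p_i:DecJump(r_1,p_l)$ gives $i(p_i,R_1,R_2),\,s(PreR_1,R_1)\Leftrightarrow i(p_{i+1},PreR_1,R_2)$ and $zero(R_1),\,i(p_i,R_1,R_2)\Leftrightarrow i(p_l,R_1,R_2),\,zero(R_1)$; - $p_i:DecJump(r_2,p_l)$ gives $i(p_i,R_1,R_2),\,s(PreR_2,R_2)\Leftrightarrow i(p_{i+1},R_1,PreR_2)$ and $zero(R_2),\,i(p_i,R_1,R_2)\Leftrightarrow i(p_l,R_1,R_2),\,zero(R_2)$. -}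

module Defs where

open import Data.Bool.Base using (if_then_else_)
open import Data.Fin.Base using (Fin; zero; suc; toℕ; fromℕ; fromℕ<; inject₁)
open import Data.List.Base
  using (List; []; _∷_; _++_; map; foldr; filter; concat; concatMap; allFin; tabulate)
open import Data.List.Membership.Propositional using (_∈_)
open import Data.List.NonEmpty.Base as List⁺ using (List⁺; _∷_)
open import Data.List.Relation.Binary.Disjoint.Propositional using (Disjoint)
open import Data.List.Relation.Binary.Permutation.Propositional using (_↭_)
open import Data.List.Relation.Unary.All using (All)
open import Data.Nat.Base using (ℕ; zero; suc; _<_)
open import Data.Nat.Properties using (_≟_)
open import Data.Product.Base using (Σ-syntax; ∃-syntax; _×_; _,_)
open import Data.Sum.Base using (_⊎_; inj₁; inj₂)
open import Data.Unit.Base using (⊤)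
open import Data.Vec.Base as Vec using (Vec; []; _∷_)
open import Function.Base using (_∘_)
open import Function.Bundles using (_⇔_)
open import Function.Definitions using (Injective)
open import Relation.Binary.Construct.Closure.ReflexiveTransitive using (Star)
open import Relation.Binary.PropositionalEquality using (_≡_)
open import Relation.Nullary using (¬_; ¬?; does)

-- CHR over a signature without function symbols of positive arity, whose
-- only built-in predicate is equality

Var : Set
Var = ℕ

module CHR (Const : Set) (Pred : Set) (arity : Pred → ℕ) where

  data Term : Set where
    var : Var → Term
    con : Const → Term

  infix 6 _$_
  data Atom (A : Set) : Set where
    _$_ : (p : Pred) → Vec A (arity p) → Atom A

  mapAtom : {A B : Set} → (A → B) → Atom A → Atom B
  mapAtom f (p $ ts) = p $ Vec.map f ts

  infix  6 _≐_
  infixr 5 _∧_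
  data Builtin : Set where
    true : Builtin
    _≐_  : Term → Term → Builtin
    _∧_  : Builtin → Builtin → Builtin
    ex   : Var → Builtin → Builtin

  ⋀ : List Builtin → Builtin
  ⋀ = foldr _∧_ true

  exs : List Var → Builtin → Builtin
  exs xs c = foldr ex c xs

  data Constraint : Set where
    builtin : Builtin → Constraint
    user    : Atom Term → Constraint

  -- Multisets are lists; every use below is invariant under permutation.
  Goal : Set
  Goal = List Constraint

  Store : Set
  Store = List (Atom Term)

  builtins : Goal → List Builtin
  builtins []              = []
  builtins (builtin c ∷ G) = c ∷ builtins G
  builtins (user _ ∷ G)    = builtins G

  users : Goal → Store
  users []              = []
  users (builtin _ ∷ G) = users G
  users (user h ∷ G)    = h ∷ users G

  fvTerm : Term → List Var
  fvTerm (var x) = x ∷ []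
  fvTerm (con _) = []

  fvAtom : Atom Term → List Var
  fvAtom (_ $ ts) = concat (map fvTerm (Vec.toList ts))

  fvBuiltin : Builtin → List Var
  fvBuiltin true     = []
  fvBuiltin (t ≐ u)  = fvTerm t ++ fvTerm u
  fvBuiltin (c ∧ d)  = fvBuiltin c ++ fvBuiltin d
  fvBuiltin (ex x c) = filter (λ y → ¬? (y ≟ x)) (fvBuiltin c)

  fvConstraint : Constraint → List Var
  fvConstraint (builtin c) = fvBuiltin c
  fvConstraint (user h)    = fvAtom h

  fvGoal : Goal → List Var
  fvGoal = concatMap fvConstraint

  fvStore : Store → List Var
  fvStore = concatMap fvAtom

  -- The constraint theory CT: its models are the structures in which "=" is
  -- identity and distinct constants denote distinct elements.  The domain is
  -- not required to consist of the denotations of constants.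

  record Model : Set₁ where
    field
      Dom       : Set
      const     : Const → Dom
      const-inj : Injective _≡_ _≡_ const

  module _ (𝓜 : Model) where
    open Model 𝓜

    Valuation : Set
    Valuation = Var → Dom

    value : Valuation → Term → Dom
    value σ (var x) = σ x
    value σ (con a) = const a

    update : Valuation → Var → Dom → Valuation
    update σ x v y = if does (y ≟ x) then v else σ y

    Holds : Valuation → Builtin → Set
    Holds σ true     = ⊤
    Holds σ (t ≐ u)  = value σ t ≡ value σ u
    Holds σ (c ∧ d)  = Holds σ c × Holds σ d
    Holds σ (ex x c) = Σ[ v ∈ Dom ] Holds (update σ x v) c

  infix 3 CT⊨_⟶_ CT⊨_⟷_

  CT⊨_⟶_ : Builtin → Builtin → Set₁
  CT⊨ c ⟶ d = (𝓜 : Model) (σ : Valuation 𝓜) → Holds 𝓜 σ c → Holds 𝓜 σ d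

  CT⊨_⟷_ : Builtin → Builtin → Set₁
  CT⊨ c ⟷ d = (CT⊨ c ⟶ d) × (CT⊨ d ⟶ c)

  -- Equations between multisets of atoms.  Equations H H′ e says that e is
  -- the constraint H = H′; there is no such e if predicate symbols differ.
  -- The pairing of the two multisets is by position, and Simplify and
  -- Propagate below choose the order of H′ freely.

  equations : {n : ℕ} → Vec Term n → Vec Term n → Builtin
  equations []       []       = true
  equations (t ∷ ts) (u ∷ us) = t ≐ u ∧ equations ts us

  data Equations : Store → Store → Builtin → Set where
    []  : Equations [] [] true
    _∷_ : {H H′ : Store} {e : Builtin} (p : Pred) {ts us : Vec Term (arity p)} →
          Equations H H′ e →
          Equations (p $ ts ∷ H) (p $ us ∷ H′) (equations ts us ∧ e)

  data Rule : Set where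
    simplification : List⁺ (Atom Term) → List Builtin → Goal → Rule
    propagation    : List⁺ (Atom Term) → List Builtin → Goal → Rule

  Program : Set
  Program = List Rule

  fvRule : Rule → List Var
  fvRule (simplification H C B) = fvStore (List⁺.toList H) ++ fvBuiltin (⋀ C) ++ fvGoal B
  fvRule (propagation H C B)    = fvStore (List⁺.toList H) ++ fvBuiltin (⋀ C) ++ fvGoal B

  -- Renamings act on bound variables too; they are only used when injective,
  -- so nothing is captured.
  module _ (ρ : Var → Var) where

    renTerm : Term → Term
    renTerm (var x) = var (ρ x)
    renTerm (con a) = con a

    renBuiltin : Builtin → Builtin
    renBuiltin true     = true
    renBuiltin (t ≐ u)  = renTerm t ≐ renTerm u
    renBuiltin (c ∧ d)  = renBuiltin c ∧ renBuiltin d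
    renBuiltin (ex x c) = ex (ρ x) (renBuiltin c)

    renConstraint : Constraint → Constraint
    renConstraint (builtin c) = builtin (renBuiltin c)
    renConstraint (user h)    = user (mapAtom renTerm h)

    renRule : Rule → Rule
    renRule (simplification H C B) = simplification
      (List⁺.map (mapAtom renTerm) H) (map renBuiltin C) (map renConstraint B)
    renRule (propagation H C B) = propagation
      (List⁺.map (mapAtom renTerm) H) (map renBuiltin C) (map renConstraint B)

  Variant : Program → Rule → Set
  Variant P r′ = ∃[ r ] ∃[ ρ ] r ∈ P × Injective _≡_ _≡_ ρ × r′ ≡ renRule ρ r

  record Config : Set where
    constructor ⟨_,_,_⟩
    field
      goal  : Goal
      store : Store
      built : Builtin

  fvConfig : Config → List Var
  fvConfig ⟨ G , K , d ⟩ = fvGoal G ++ fvStore K ++ fvBuiltin d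

  FreshVariant : Program → List Var → Config → Rule → Set
  FreshVariant P V γ r = Variant P r × Disjoint (fvRule r) (V ++ fvConfig γ)

  -- V is the set of variables of the initial goal.  Renamed rules avoid it
  -- together with the variables of the current configuration, since Solve may
  -- make a variable disappear from the configuration.

  infix 3 _∣_⊢_⟶_
  data _∣_⊢_⟶_ (P : Program) (V : List Var) : Config → Config → Set₁ where

    solve : {G G′ : Goal} {K : Store} {c d d′ : Builtin} →
      G ↭ builtin c ∷ G′ →
      CT⊨ c ∧ d ⟷ d′ →
      P ∣ V ⊢ ⟨ G , K , d ⟩ ⟶ ⟨ G′ , K , d′ ⟩

    introduce : {G G′ : Goal} {K : Store} {h : Atom Term} {d : Builtin} →
      G ↭ user h ∷ G′ →
      P ∣ V ⊢ ⟨ G , K , d ⟩ ⟶ ⟨ G′ , h ∷ K , d ⟩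

    simplify : {G B : Goal} {K K₀ H′ : Store} {d e : Builtin}
      {H : List⁺ (Atom Term)} {C : List Builtin} →
      K ↭ H′ ++ K₀ →
      FreshVariant P V ⟨ G , K , d ⟩ (simplification H C B) →
      Equations (List⁺.toList H) H′ e →
      CT⊨ d ⟶ exs (fvStore (List⁺.toList H)) (e ∧ ⋀ C) →
      P ∣ V ⊢ ⟨ G , K , d ⟩ ⟶ ⟨ B ++ G , K₀ , e ∧ d ⟩

    propagate : {G B : Goal} {K K₀ H′ : Store} {d e : Builtin}
      {H : List⁺ (Atom Term)} {C : List Builtin} →
      K ↭ H′ ++ K₀ →
      FreshVariant P V ⟨ G , K , d ⟩ (propagation H C B) →
      Equations (List⁺.toList H) H′ e →
      CT⊨ d ⟶ exs (fvStore (List⁺.toList H)) (e ∧ ⋀ C) →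
      P ∣ V ⊢ ⟨ G , K , d ⟩ ⟶ ⟨ B ++ G , H′ ++ K₀ , e ∧ d ⟩

  Final : Program → List Var → Config → Set₁
  Final P V γ = ¬ (∃[ γ′ ] P ∣ V ⊢ γ ⟶ γ′)

  -- ∃₋[ V ] φ is the existential closure of the conjunction φ except for the
  -- variables in V.

  infix 4 ∃₋[_]_
  record Answer : Set where
    constructor ∃₋[_]_
    field
      visible : List Var
      body    : Goal

  data QA (P : Program) (G : Goal) : Answer → Set₁ where
    qa : {K : Store} {d : Builtin} →
      Star (P ∣ fvGoal G ⊢_⟶_) ⟨ G , [] , true ⟩ ⟨ [] , K , d ⟩ →
      Final P (fvGoal G) ⟨ [] , K , d ⟩ →
      QA P G (∃₋[ fvGoal G ] (map user K ++ builtin d ∷ []))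

  -- Logical equivalence of answers.  Built-ins are interpreted in a model of
  -- CT; since multiplicities of user-defined constraints count, these are
  -- interpreted by a multiset N of ground facts, which the user-defined
  -- constraints of an answer have to match exactly.

  Satisfies : (𝓜 : Model) → Valuation 𝓜 → List (Atom (Model.Dom 𝓜)) → Answer → Set
  Satisfies 𝓜 σ N (∃₋[ V ] φ) = Σ[ τ ∈ Valuation 𝓜 ]
    ((x : Var) → x ∈ V → τ x ≡ σ x) ×
    All (Holds 𝓜 τ) (builtins φ) ×
    map (mapAtom (value 𝓜 τ)) (users φ) ↭ N

  infix 4 _≈_
  _≈_ : Answer → Answer → Set₁
  A ≈ A′ = (𝓜 : Model) (σ : Valuation 𝓜) (N : List (Atom (Model.Dom 𝓜))) →
    Satisfies 𝓜 σ N A ⇔ Satisfies 𝓜 σ N A′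

  HasQualifiedAnswer : Program → Goal → Answer → Set₁
  HasQualifiedAnswer P G A = ∃[ A′ ] QA P G A′ × A′ ≈ A

data Reg : Set where
  r₁ r₂ : Reg

-- The instruction at position j (positions 1, …, n are the elements of Fin n).
-- The inequalities say that the successor position lies in the program.
data Instr (n : ℕ) (j : Fin n) : Set where
  succ    : Reg → suc (toℕ j) < n → Instr n j
  decJump : Reg → Fin n → suc (toℕ j) < n → Instr n j
  halt    : Instr n j

Machine : ℕ → Set
Machine n = (j : Fin n) → Instr n j

Registers : Set
Registers = ℕ × ℕ

get : Reg → Registers → ℕ
get r₁ (a , b) = a
get r₂ (a , b) = b

set : Reg → ℕ → Registers → Registers
set r₁ x (a , b) = (x , b)
set r₂ x (a , b) = (a , x)

State : ℕ → Set
State n = Fin n × Registers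

infix 3 _⊢_↝_
data _⊢_↝_ {n : ℕ} (M : Machine n) : State n → State n → Set where

  succ : {j : Fin n} {r : Reg} {j+1<n : suc (toℕ j) < n} {v : Registers} →
    M j ≡ succ r j+1<n →
    M ⊢ (j , v) ↝ (fromℕ< j+1<n , set r (suc (get r v)) v)

  dec : {j l : Fin n} {r : Reg} {j+1<n : suc (toℕ j) < n} {v : Registers} {x : ℕ} →
    M j ≡ decJump r l j+1<n →
    get r v ≡ suc x →
    M ⊢ (j , v) ↝ (fromℕ< j+1<n , set r x v)

  jump : {j l : Fin n} {r : Reg} {j+1<n : suc (toℕ j) < n} {v : Registers} →
    M j ≡ decJump r l j+1<n →
    get r v ≡ 0 →
    M ⊢ (j , v) ↝ (l , v)

HaltsWithOutput : {n : ℕ} → Machine (suc n) → ℕ → ℕ → ℕ → Set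
HaltsWithOutput M v₀ v₁ k =
  ∃[ j ] ∃[ b ] Star (M ⊢_↝_) (zero , (v₀ , v₁)) (j , (k , b)) × M j ≡ halt

data TCMPred : Set where
  iₚ sₚ zeroₚ : TCMPred

tcmArity : TCMPred → ℕ
tcmArity iₚ    = 3
tcmArity sₚ    = 2
tcmArity zeroₚ = 1

-- The constants are the n instruction numbers and e further ones.
module Encoding (n : ℕ) (e : ℕ) where

  open CHR (Fin n ⊎ Fin e) TCMPred tcmArity public

  i⟨_,_,_⟩ : Fin n → Var → Var → Atom Term
  i⟨ j , x , y ⟩ = iₚ $ (con (inj₁ j) ∷ var x ∷ var y ∷ [])

  s⟨_,_⟩ : Var → Var → Atom Term
  s⟨ x , y ⟩ = sₚ $ (var x ∷ var y ∷ [])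

  zero⟨_⟩ : Var → Atom Term
  zero⟨ x ⟩ = zeroₚ $ (var x ∷ [])

  R₁ R₂ SuccR₁ SuccR₂ PreR₁ PreR₂ : Var
  R₁     = 0
  R₂     = 1
  SuccR₁ = 2
  SuccR₂ = 3
  PreR₁  = 4
  PreR₂  = 5

  infix 2 _⟺_
  _⟺_ : List⁺ (Atom Term) → List (Atom Term) → Rule
  H ⟺ B = simplification H [] (map user B)

  encodeInstr : (j : Fin n) → Instr n j → List Rule
  encodeInstr j (succ r₁ j+1<n) =
    (i⟨ j , R₁ , R₂ ⟩ ∷ [] ⟺ s⟨ R₁ , SuccR₁ ⟩ ∷ i⟨ fromℕ< j+1<n , SuccR₁ , R₂ ⟩ ∷ []) ∷ []
  encodeInstr j (succ r₂ j+1<n) =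
    (i⟨ j , R₁ , R₂ ⟩ ∷ [] ⟺ s⟨ R₂ , SuccR₂ ⟩ ∷ i⟨ fromℕ< j+1<n , R₁ , SuccR₂ ⟩ ∷ []) ∷ []
  encodeInstr j (decJump r₁ l j+1<n) =
    (i⟨ j , R₁ , R₂ ⟩ ∷ s⟨ PreR₁ , R₁ ⟩ ∷ [] ⟺ i⟨ fromℕ< j+1<n , PreR₁ , R₂ ⟩ ∷ []) ∷
    (zero⟨ R₁ ⟩ ∷ i⟨ j , R₁ , R₂ ⟩ ∷ [] ⟺ i⟨ l , R₁ , R₂ ⟩ ∷ zero⟨ R₁ ⟩ ∷ []) ∷ []
  encodeInstr j (decJump r₂ l j+1<n) =
    (i⟨ j , R₁ , R₂ ⟩ ∷ s⟨ PreR₂ , R₂ ⟩ ∷ [] ⟺ i⟨ fromℕ< j+1<n , R₁ , PreR₂ ⟩ ∷ []) ∷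
    (zero⟨ R₂ ⟩ ∷ i⟨ j , R₁ , R₂ ⟩ ∷ [] ⟺ i⟨ l , R₁ , R₂ ⟩ ∷ zero⟨ R₂ ⟩ ∷ []) ∷ []
  encodeInstr j halt = []

  ⟦_⟧₂ : Machine n → Program
  ⟦ M ⟧₂ = concatMap (λ j → encodeInstr j (M j)) (allFin n)

  initialGoal : Fin n → Goal
  initialGoal j = user zero⟨ R₁ ⟩ ∷ user zero⟨ R₂ ⟩ ∷ user i⟨ j , R₁ , R₂ ⟩ ∷ []

  answer₀ : Fin n → Var → Goal → Answer
  answer₀ j R₂′ H = ∃₋[ R₁ ∷ R₂ ∷ [] ]
    (user i⟨ j , R₁ , R₂′ ⟩ ∷ user zero⟨ R₁ ⟩ ∷ H)

  -- Here k = m + 1, and S enumerates SuccR₁¹, …, SuccR₁ᵏ starting from index zero.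
  answer₊ : {m : ℕ} → Fin n → Var → (Fin (suc m) → Var) → Goal → Answer
  answer₊ {m} j R₂′ S H = ∃₋[ R₁ ∷ R₂ ∷ [] ]
    (user i⟨ j , S (fromℕ m) , R₂′ ⟩ ∷ user zero⟨ R₁ ⟩ ∷ user s⟨ R₁ , S zero ⟩ ∷
     tabulate {n = m} (λ q → user s⟨ S (inject₁ q) , S (suc q) ⟩) ++ H)

{-# OPTIONS --safe #-}
module Submission where

-- A configuration reached from the initial goal encodes a machine state: up to the
-- equalities entailed by its built-in constraint d, its user-defined constraints are one
-- atom i and, for each register, a chain of atoms s hanging from an atom zero.  The
-- invariant also says that d leaves the chain variables unconstrained.  Hence d has a
-- solution in which all these variables take distinct values, and under it a rule head
-- can only match the atom i and the top of a chain, so that every Simplify step is the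
-- machine step.  The same solution recovers the value of R₁ from an answer, by removing
-- the atoms s of both chains from the top down.

open import Defs
open import Data.Bool.Base using (if_then_else_)
open import Data.Empty using (⊥-elim)
open import Data.Fin.Base using (Fin; zero; suc; toℕ; fromℕ; fromℕ<; inject₁)
open import Data.List.Base
  using (List; []; _∷_; _++_; map; concatMap; length; tabulate; reverse; _ʳ++_; allFin)
open import Data.List.Extrema.Nat using (max; xs≤max)
import Data.List.Membership.DecPropositional as DecMembership
open import Data.List.Membership.Propositional using (_∈_; _∉_; find; lose)
open import Data.List.Membership.Propositional.Properties
  using (∈-++⁺ˡ; ∈-++⁺ʳ; ∈-++⁻; ∈-filter⁺; ∈-concatMap⁺; ∈-concatMap⁻; ∈-map⁺; ∈-map⁻; ∈-allFin)
open import Data.List.NonEmpty.Base as List⁺ using (List⁺; _∷_)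
open import Data.List.Properties
  using (map-∘; map-++; map-tabulate; ++-assoc; ++-identityʳ; reverse-involutive;
         length-tabulate; length-reverse)
open import Data.List.Relation.Binary.Disjoint.Propositional using (Disjoint)
import Data.List.Relation.Binary.Permutation.Homogeneous as Homogeneous
open import Data.List.Relation.Binary.Permutation.Propositional
  using (_↭_; ↭-refl; ↭-sym; ↭-trans; ↭-reflexive; ↭⇒↭ₛ; ↭⇒↭ₛ′; ↭ₛ⇒↭;
         module PermutationReasoning)
import Data.List.Relation.Binary.Permutation.Propositional.Properties as ↭ₚ
import Data.List.Relation.Binary.Permutation.Setoid as SetoidPermutation
import Data.List.Relation.Binary.Permutation.Setoid.Properties as SetoidPermutationProperties
open import Data.List.Relation.Binary.Pointwise as Pointwise using (Pointwise; []; _∷_)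
open import Data.List.Relation.Unary.All as All using (All; []; _∷_)
open import Data.List.Relation.Unary.AllPairs using ([]; _∷_)
open import Data.List.Relation.Unary.Any using (Any; here; there)
import Data.List.Relation.Unary.Any.Properties as Anyₚ
open import Data.List.Relation.Unary.Unique.Propositional using (Unique)
open import Data.List.Relation.Unary.Unique.Propositional.Properties using (Unique[x∷xs]⇒x∉xs)
open import Data.Nat.Base using (ℕ; zero; suc; _+_; _∸_; _<_)
open import Data.Nat.Properties using (_≟_; +-cancelˡ-≡; m≤m+n; m+n∸m≡n; <-irrefl; ≤-trans)
open import Data.Product.Base using (Σ-syntax; ∃-syntax; _×_; _,_; proj₁; proj₂)
open import Data.Sum.Base as Sum using (_⊎_; inj₁; inj₂)
open import Data.Unit.Base using (tt)
open import Data.Vec.Base as Vec using (Vec; []; _∷_)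
import Data.Vec.Properties as Vecₚ
open import Function.Base using (_∘_)
open import Function.Bundles using (_⇔_; mk⇔; Equivalence)
open import Function.Definitions using (Injective)
open import Level using (Level; 0ℓ) renaming (suc to lsuc)
open import Relation.Binary.Bundles using (Setoid)
open import Relation.Binary.Construct.Closure.ReflexiveTransitive using (Star; ε; _◅_; _◅◅_)
open import Relation.Binary.Core using (Rel)
open import Relation.Binary.PropositionalEquality as ≡
  using (_≡_; _≢_; refl; sym; trans; cong; cong₂; subst; subst₂)
open import Relation.Nullary using (¬_; ¬?; yes; no; does; contradiction)
open import Relation.Nullary.Decidable using (dec-true; dec-false)

-- Rule bodies bring in renamed rule variables, and the equations tying these to the consumed atoms
-- go to `d` without being applied to the store. Stores are therefore compared with encodings by
-- permutations modulo `d`: equalities of atoms that hold in every solution of `d` in every model.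
-- Freedom of the chain variables survives Simplify because the guard extends each solution of `d`
-- by values for the fresh head variables only, so values prescribed for older variables are kept.
-- It is required in every model, since in the equivalence of answers an arbitrary assignment of the
-- chain variables has to extend to a solution of `d`. It also makes `d` satisfiable; otherwise
-- equality modulo `d` would carry no information. Finitely many constants cannot provide distinct
-- values for unboundedly many variables, so the model `generic` adds an element for each variable.
-- A solution there decides which atom a head matches; the equalities for that atom are then
-- available in every model.

tabulate-surjective : {A : Set} {m : ℕ} (xs : List A) → length xs ≡ m →
  Σ[ S ∈ (Fin m → A) ] tabulate S ≡ xs
tabulate-surjective []       refl = (λ ()) , refl
tabulate-surjective (x ∷ xs) refl with tabulate-surjective xs refl
... | S , eq = (λ { zero → x ; (suc q) → S q }) , cong (x ∷_) eq

∈-concatMap-⊆ : {A B : Set} (f : A → List B) {xs ys : List A} {y : B} →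
  (∀ {x} → x ∈ xs → x ∈ ys) → y ∈ concatMap f xs → y ∈ concatMap f ys
∈-concatMap-⊆ f {xs} xs⊆ys y∈ with find (∈-concatMap⁻ f {xs} y∈)
... | _ , x∈xs , y∈fx = ∈-concatMap⁺ f (lose (xs⊆ys x∈xs) y∈fx)

-- Permutations up to a transitive relation.

module _ {A : Set} {ℓ : Level} {R : Rel A ℓ} (R-trans : ∀ {x y z} → R x y → R y z → R x z) where

  -- Simplify asks for a permutation of the store itself, while the invariant provides one modulo
  -- `d`. Transitivity lets all uses of the relation be moved behind the rearrangement.
  permute-pointwise : ∀ {xs ys zs} → Pointwise R xs ys → Homogeneous.Permutation R ys zs →
    ∃[ ws ] xs ↭ ws × Pointwise R ws zs
  permute-pointwise p (Homogeneous.refl q) = _ , ↭-refl , Pointwise.transitive R-trans p q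
  permute-pointwise (x∼y ∷ p) (Homogeneous.prep y∼z q) with permute-pointwise p q
  ... | ws , xs↭ws , r = _ , _↭_.prep _ xs↭ws , R-trans x∼y y∼z ∷ r
  permute-pointwise (x∼y ∷ x′∼y′ ∷ p) (Homogeneous.swap y∼z y′∼z′ q) with permute-pointwise p q
  ... | ws , xs↭ws , r =
    _ , _↭_.swap _ _ xs↭ws , R-trans x′∼y′ y′∼z′ ∷ R-trans x∼y y∼z ∷ r
  permute-pointwise p (Homogeneous.trans q₁ q₂) with permute-pointwise p q₁
  ... | _ , xs↭vs , r with permute-pointwise r q₂
  ... | ws , vs↭ws , s = ws , ↭-trans xs↭vs vs↭ws , s

pointwise-split : {A : Set} {ℓ : Level} {R : Rel A ℓ} (ys : List A) {xs zs : List A} →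
  Pointwise R xs (ys ++ zs) → ∃[ us ] ∃[ vs ] xs ≡ us ++ vs × Pointwise R us ys
pointwise-split []       {xs} p = [] , xs , refl , []
pointwise-split (y ∷ ys) (x∼y ∷ p) with pointwise-split ys p
... | us , vs , refl , q = _ ∷ us , vs , refl , x∼y ∷ q

-- Valuations and the truth of built-in constraints.

module CHRProperties (Const : Set) (Pred : Set) (arity : Pred → ℕ) where

  open CHR Const Pred arity
  open DecMembership _≟_ using (_∈?_)

  $-injective : {A : Set} {p : Pred} {ts us : Vec A (arity p)} → p $ ts ≡ p $ us → ts ≡ us
  $-injective refl = refl

  pred : {A : Set} → Atom A → Pred
  pred (p $ _) = p

  pred-mapAtom : {A B : Set} (f : A → B) (a : Atom A) → pred (mapAtom f a) ≡ pred a
  pred-mapAtom f (p $ _) = refl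

  module _ (𝓜 : Model) where
    open Model 𝓜

    update-same : (σ : Valuation 𝓜) (x : Var) (v : Dom) → update 𝓜 σ x v x ≡ v
    update-same σ x v rewrite dec-true (x ≟ x) refl = refl

    update-other : (σ : Valuation 𝓜) {x y : Var} (v : Dom) → y ≢ x → update 𝓜 σ x v y ≡ σ y
    update-other σ {x} {y} v y≢x rewrite dec-false (y ≟ x) y≢x = refl

    AgreeOn : (Var → Set) → Valuation 𝓜 → Valuation 𝓜 → Set
    AgreeOn U σ τ = ∀ {x} → U x → σ x ≡ τ x

    update-cong : {U : Var → Set} {σ τ : Valuation 𝓜} (x : Var) (v : Dom) →
      (∀ {y} → U y → y ≢ x → σ y ≡ τ y) → AgreeOn U (update 𝓜 σ x v) (update 𝓜 τ x v)
    update-cong {σ = σ} {τ} x v agree {y} y∈U with y ≟ x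
    ... | yes refl = trans (update-same σ x v) (sym (update-same τ x v))
    ... | no y≢x = trans (update-other σ v y≢x)
                     (trans (agree y∈U y≢x) (sym (update-other τ v y≢x)))

    value-cong : {σ τ : Valuation 𝓜} (t : Term) →
      AgreeOn (_∈ fvTerm t) σ τ → value 𝓜 σ t ≡ value 𝓜 τ t
    value-cong (var x) agree = agree (here refl)
    value-cong (con a) agree = refl

    values-cong : {σ τ : Valuation 𝓜} {m : ℕ} (ts : Vec Term m) →
      AgreeOn (_∈ concatMap fvTerm (Vec.toList ts)) σ τ →
      Vec.map (value 𝓜 σ) ts ≡ Vec.map (value 𝓜 τ) ts
    values-cong []       agree = refl
    values-cong (t ∷ ts) agree = cong₂ _∷_
      (value-cong t (agree ∘ ∈-++⁺ˡ)) (values-cong ts (agree ∘ ∈-++⁺ʳ (fvTerm t)))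

    atom-cong : {σ τ : Valuation 𝓜} (a : Atom Term) →
      AgreeOn (_∈ fvAtom a) σ τ → mapAtom (value 𝓜 σ) a ≡ mapAtom (value 𝓜 τ) a
    atom-cong (p $ ts) agree = cong (p $_) (values-cong ts agree)

    holds-cong : {σ τ : Valuation 𝓜} (c : Builtin) →
      AgreeOn (_∈ fvBuiltin c) σ τ → Holds 𝓜 σ c → Holds 𝓜 τ c
    holds-cong true     agree _ = tt
    holds-cong (t ≐ u)  agree h = trans (sym (value-cong t (agree ∘ ∈-++⁺ˡ)))
      (trans h (value-cong u (agree ∘ ∈-++⁺ʳ (fvTerm t))))
    holds-cong (c ∧ d)  agree (h , k) =
      holds-cong c (agree ∘ ∈-++⁺ˡ) h , holds-cong d (agree ∘ ∈-++⁺ʳ (fvBuiltin c)) k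
    holds-cong (ex x c) agree (v , h) = v , holds-cong c (update-cong x v λ y∈c y≢x →
      agree (∈-filter⁺ (λ y → ¬? (y ≟ x)) y∈c y≢x)) h

    -- One valuation supplies the witnesses of all quantifiers at once. Repetitions in `xs` do no
    -- harm, which matters because `fvStore` lists a variable once per occurrence.
    exs-intro : {c : Builtin} (xs : List Var) {σ τ : Valuation 𝓜} →
      AgreeOn (_∉ xs) σ τ → Holds 𝓜 τ c → Holds 𝓜 σ (exs xs c)
    exs-intro {c} []       agree h = holds-cong c (λ _ → sym (agree λ ())) h
    exs-intro     (x ∷ xs) {σ} {τ} agree h = τ x , exs-intro xs agree′ h
      where
      agree′ : AgreeOn (_∉ xs) (update 𝓜 σ x (τ x)) τ
      agree′ {y} y∉xs with y ≟ x
      ... | yes refl = update-same σ x (τ x)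
      ... | no y≢x = trans (update-other σ (τ x) y≢x)
                       (agree λ { (here y≡x) → y≢x y≡x ; (there y∈xs) → y∉xs y∈xs })

    exs-elim : {c : Builtin} (xs : List Var) {σ : Valuation 𝓜} →
      Holds 𝓜 σ (exs xs c) → Σ[ τ ∈ Valuation 𝓜 ] AgreeOn (_∉ xs) σ τ × Holds 𝓜 τ c
    exs-elim []       {σ} h       = σ , (λ _ → refl) , h
    exs-elim (x ∷ xs) {σ} (v , h) with exs-elim xs h
    ... | τ , agree , k = τ , agree′ , k
      where
      agree′ : AgreeOn (_∉ x ∷ xs) σ τ
      agree′ y∉ = trans (sym (update-other σ v (y∉ ∘ here))) (agree (y∉ ∘ there))

    store-cong : {σ τ : Valuation 𝓜} (K : Store) → AgreeOn (_∈ fvStore K) σ τ →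
      map (mapAtom (value 𝓜 σ)) K ≡ map (mapAtom (value 𝓜 τ)) K
    store-cong []      agree = refl
    store-cong (a ∷ K) agree = cong₂ _∷_
      (atom-cong a (agree ∘ ∈-++⁺ˡ)) (store-cong K (agree ∘ ∈-++⁺ʳ (fvAtom a)))

    equations-sound : {σ : Valuation 𝓜} {m : ℕ} (ts us : Vec Term m) →
      Holds 𝓜 σ (equations ts us) → Vec.map (value 𝓜 σ) ts ≡ Vec.map (value 𝓜 σ) us
    equations-sound []       []       _         = refl
    equations-sound (t ∷ ts) (u ∷ us) (eq , eqs) = cong₂ _∷_ eq (equations-sound ts us eqs)

    equations-complete : {σ : Valuation 𝓜} {m : ℕ} (ts us : Vec Term m) →
      Vec.map (value 𝓜 σ) ts ≡ Vec.map (value 𝓜 σ) us → Holds 𝓜 σ (equations ts us)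
    equations-complete []       []       _  = tt
    equations-complete (t ∷ ts) (u ∷ us) eq =
      cong Vec.head eq , equations-complete ts us (cong Vec.tail eq)

  -- Equality and permutation of atoms modulo a built-in constraint.

  infix 3 _⊢_≋_ _⊢_↭_

  _⊢_≋_ : Builtin → Atom Term → Atom Term → Set₁
  d ⊢ a ≋ b = (𝓜 : Model) (σ : Valuation 𝓜) → Holds 𝓜 σ d →
    mapAtom (value 𝓜 σ) a ≡ mapAtom (value 𝓜 σ) b

  ≋-setoid : Builtin → Setoid 0ℓ (lsuc 0ℓ)
  ≋-setoid d = record
    { Carrier = Atom Term
    ; _≈_ = d ⊢_≋_
    ; isEquivalence = record
      { refl  = λ 𝓜 σ h → refl
      ; sym   = λ eq 𝓜 σ h → sym (eq 𝓜 σ h)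
      ; trans = λ eq eq′ 𝓜 σ h → trans (eq 𝓜 σ h) (eq′ 𝓜 σ h)
      }
    }

  module ≋ (d : Builtin) = Setoid (≋-setoid d)

  _⊢_↭_ : Builtin → Store → Store → Set₁
  d ⊢ K ↭ L = Homogeneous.Permutation (d ⊢_≋_) K L

  module ↭ᵈ {d : Builtin} where
    open SetoidPermutation (≋-setoid d) public
      using (↭-refl)
    open SetoidPermutationProperties (≋-setoid d) public
      using (++⁺ʳ; drop-∷; Any-resp-↭)

  fromPropositional : {d : Builtin} {K L : Store} → K ↭ L → d ⊢ K ↭ L
  fromPropositional {d} = ↭⇒↭ₛ′ (≋.isEquivalence d)

  weaken : {c d : Builtin} {K L : Store} → d ⊢ K ↭ L → c ∧ d ⊢ K ↭ L
  weaken = Homogeneous.map λ eq 𝓜 σ (_ , h) → eq 𝓜 σ h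

  evaluate : {d : Builtin} {K L : Store} (𝓜 : Model) (σ : Valuation 𝓜) → Holds 𝓜 σ d →
    d ⊢ K ↭ L → map (mapAtom (value 𝓜 σ)) K ↭ map (mapAtom (value 𝓜 σ)) L
  evaluate {d} 𝓜 σ h p =
    ↭ₛ⇒↭ (SetoidPermutationProperties.map⁺ (≋-setoid d) (≡.setoid _) (λ eq → eq 𝓜 σ h) p)

  head-≋ : {d : Builtin} {a : Atom Term} {K L : Store} → d ⊢ a ∷ K ↭ L → Any (d ⊢ a ≋_) L
  head-≋ {d} {a} p = ↭ᵈ.Any-resp-↭ {d} {P = d ⊢ a ≋_}
    (λ {b} {c} b≋c a≋b → ≋.trans d {a} {b} {c} a≋b b≋c) p (here (≋.refl d {a}))

  cancel-≋ : {d : Builtin} {a b : Atom Term} {K L : Store} →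
    d ⊢ a ≋ b → d ⊢ a ∷ K ↭ b ∷ L → d ⊢ K ↭ L
  cancel-≋ {d} {a} {b} a≋b p = ↭ᵈ.drop-∷ {d}
    (Homogeneous.trans (Homogeneous.prep (≋.sym d {a} {b} a≋b) (↭ᵈ.↭-refl {d})) p)

  -- Equations between stores, and variables left unconstrained.

  fv-equations : {m : ℕ} (ts us : Vec Term m) {x : Var} → x ∈ fvBuiltin (equations ts us) →
    x ∈ concatMap fvTerm (Vec.toList ts) ⊎ x ∈ concatMap fvTerm (Vec.toList us)
  fv-equations []       []       ()
  fv-equations (t ∷ ts) (u ∷ us) x∈ with ∈-++⁻ (fvTerm t ++ fvTerm u) x∈
  ... | inj₁ x∈tu = Sum.map ∈-++⁺ˡ ∈-++⁺ˡ (∈-++⁻ (fvTerm t) x∈tu)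
  ... | inj₂ x∈′  = Sum.map (∈-++⁺ʳ (fvTerm t)) (∈-++⁺ʳ (fvTerm u)) (fv-equations ts us x∈′)

  equations-fvʳ : {m : ℕ} (ts us : Vec Term m) {x : Var} →
    x ∈ concatMap fvTerm (Vec.toList us) → x ∈ fvBuiltin (equations ts us)
  equations-fvʳ []       []       ()
  equations-fvʳ (t ∷ ts) (u ∷ us) x∈ with ∈-++⁻ (fvTerm u) x∈
  ... | inj₁ x∈u  = ∈-++⁺ˡ (∈-++⁺ʳ (fvTerm t) x∈u)
  ... | inj₂ x∈us = ∈-++⁺ʳ (fvTerm t ++ fvTerm u) (equations-fvʳ ts us x∈us)

  fv-Equations : {H H′ : Store} {e : Builtin} → Equations H H′ e → {x : Var} →
    x ∈ fvBuiltin e → x ∈ fvStore H ⊎ x ∈ fvStore H′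
  fv-Equations (_∷_ p {ts} {us} E) x∈ with ∈-++⁻ (fvBuiltin (equations ts us)) x∈
  ... | inj₁ x∈p = Sum.map ∈-++⁺ˡ ∈-++⁺ˡ (fv-equations ts us x∈p)
  ... | inj₂ x∈E =
    Sum.map (∈-++⁺ʳ (fvAtom (p $ ts))) (∈-++⁺ʳ (fvAtom (p $ us))) (fv-Equations E x∈E)

  Equations-fvʳ : {H H′ : Store} {e : Builtin} → Equations H H′ e → {x : Var} →
    x ∈ fvStore H′ → x ∈ fvBuiltin e
  Equations-fvʳ (_∷_ p {ts} {us} E) x∈ with ∈-++⁻ (fvAtom (p $ us)) x∈
  ... | inj₁ x∈us = ∈-++⁺ˡ (equations-fvʳ ts us x∈us)
  ... | inj₂ x∈H′ = ∈-++⁺ʳ (fvBuiltin (equations ts us)) (Equations-fvʳ E x∈H′)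

  Equations-sound : {H H′ : Store} {d e : Builtin} → Equations H H′ e →
    Pointwise (e ∧ d ⊢_≋_) H H′
  Equations-sound []                    = []
  Equations-sound (_∷_ p {ts} {us} E) =
    (λ 𝓜 σ ((h , _) , _) → cong (p $_) (equations-sound 𝓜 ts us h)) ∷
    Pointwise.map (λ eq 𝓜 σ ((_ , h) , k) → eq 𝓜 σ (h , k)) (Equations-sound E)

  Equations-complete : {H H′ : Store} {e : Builtin} → Equations H H′ e →
    (𝓜 : Model) {σ : Valuation 𝓜} →
    Pointwise (λ a b → mapAtom (value 𝓜 σ) a ≡ mapAtom (value 𝓜 σ) b) H H′ → Holds 𝓜 σ e
  Equations-complete []                  𝓜 []         = tt
  Equations-complete (_∷_ p {ts} {us} E) 𝓜 (eq ∷ eqs) =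
    equations-complete 𝓜 ts us ($-injective eq) , Equations-complete E 𝓜 eqs

  Equations-exist : {H H′ : Store} → Pointwise (λ a b → pred a ≡ pred b) H H′ →
    ∃[ e ] Equations H H′ e
  Equations-exist [] = true , []
  Equations-exist {p $ _ ∷ _} {.p $ _ ∷ _} (refl ∷ ps) with Equations-exist ps
  ... | e , E = _ , p ∷ E

  -- With `U` empty this is satisfiability of `d` in every model. The prescribed values come from an
  -- arbitrary valuation, so they can be chosen distinct in `generic` and may coincide elsewhere.
  Unconstrained : Builtin → (Var → Set) → Set₁
  Unconstrained d U = (𝓜 : Model) (σ : Valuation 𝓜) →
    Σ[ τ ∈ Valuation 𝓜 ] Holds 𝓜 τ d × AgreeOn 𝓜 U τ σ

  -- A solution of `d` with the prescribed values on `U` satisfies the guard, whose witnesses change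
  -- it only on `xs`. Both `U` and the variables of `d` lie in `W`, away from `xs`, so the values on
  -- `U` and the truth of `d` persist.
  unconstrained-guard : {d e c : Builtin} {U : Var → Set} {xs W : List Var} →
    CT⊨ d ⟶ exs xs (e ∧ c) → Disjoint xs W →
    (∀ {x} → U x → x ∈ W) → (∀ {x} → x ∈ fvBuiltin d → x ∈ W) →
    Unconstrained d U → Unconstrained (e ∧ d) U
  unconstrained-guard {d} {xs = xs} guard xs#W U⊆W d⊆W free 𝓜 σ with free 𝓜 σ
  ... | τ , h , τ≈σ with exs-elim 𝓜 xs (guard 𝓜 τ h)
  ... | τ′ , τ≈τ′ , (k , _) =
    τ′ , (k , holds-cong 𝓜 d (λ x∈d → τ≈τ′ (λ x∈xs → xs#W (x∈xs , d⊆W x∈d))) h) ,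
    λ x∈U → trans (sym (τ≈τ′ (λ x∈xs → xs#W (x∈xs , U⊆W x∈U)))) (τ≈σ x∈U)

  -- A variable that does not occur in `d` can be given its value after `d` has been solved.
  unconstrained-fresh : {d : Builtin} {U U′ : Var → Set} {z : Var} → z ∉ fvBuiltin d →
    (∀ {x} → U′ x → x ≡ z ⊎ U x) → Unconstrained d U → Unconstrained d U′
  unconstrained-fresh {d} {U} {U′} {z} z∉d U′⊆ free 𝓜 σ with free 𝓜 σ
  ... | τ , h , τ≈σ =
    update 𝓜 τ z (σ z) ,
    holds-cong 𝓜 d (λ {x} x∈d → sym (update-other 𝓜 τ {z} {x} (σ z) λ { refl → z∉d x∈d })) h ,
    agree
    where
    agree : AgreeOn 𝓜 U′ (update 𝓜 τ z (σ z)) σ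
    agree {x} x∈U′ with x ≟ z | U′⊆ x∈U′
    ... | yes refl | _        = update-same 𝓜 τ z (σ z)
    ... | no x≢z   | inj₁ x≡z = contradiction x≡z x≢z
    ... | no x≢z   | inj₂ x∈U = trans (update-other 𝓜 τ (σ z) x≢z) (τ≈σ x∈U)

  -- The second summand holds one value for each variable, different from all other such values and
  -- from every constant; `generic-valuation` assigns them.
  generic : Model
  generic = record { Dom = Const ⊎ ℕ ; const = inj₁ ; const-inj = λ { refl → refl } }

  generic-valuation : Valuation generic
  generic-valuation = inj₂

  -- Renamings, free variables and the user-defined part of goals.

  renAtom : (Var → Var) → Atom Term → Atom Term
  renAtom ρ = mapAtom (renTerm ρ)

  value-ren : (𝓜 : Model) (σ : Valuation 𝓜) (ρ : Var → Var) (t : Term) →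
    value 𝓜 σ (renTerm ρ t) ≡ value 𝓜 (σ ∘ ρ) t
  value-ren 𝓜 σ ρ (var x) = refl
  value-ren 𝓜 σ ρ (con a) = refl

  value-renAtom : (𝓜 : Model) (σ : Valuation 𝓜) (ρ : Var → Var) (a : Atom Term) →
    mapAtom (value 𝓜 σ) (renAtom ρ a) ≡ mapAtom (value 𝓜 (σ ∘ ρ)) a
  value-renAtom 𝓜 σ ρ (p $ ts) =
    cong (p $_) (trans (sym (Vecₚ.map-∘ _ _ ts)) (Vecₚ.map-cong (value-ren 𝓜 σ ρ) ts))

  fv-renTerms : (ρ : Var → Var) {m : ℕ} (ts : Vec Term m) →
    concatMap fvTerm (Vec.toList (Vec.map (renTerm ρ) ts)) ≡
    map ρ (concatMap fvTerm (Vec.toList ts))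
  fv-renTerms ρ []           = refl
  fv-renTerms ρ (var x ∷ ts) = cong (ρ x ∷_) (fv-renTerms ρ ts)
  fv-renTerms ρ (con a ∷ ts) = fv-renTerms ρ ts

  fvAtom-ren : (ρ : Var → Var) (a : Atom Term) → fvAtom (renAtom ρ a) ≡ map ρ (fvAtom a)
  fvAtom-ren ρ (p $ ts) = fv-renTerms ρ ts

  fvStore-ren : (ρ : Var → Var) (K : Store) →
    fvStore (map (renAtom ρ) K) ≡ map ρ (fvStore K)
  fvStore-ren ρ []      = refl
  fvStore-ren ρ (a ∷ K) = trans (cong₂ _++_ (fvAtom-ren ρ a) (fvStore-ren ρ K))
    (sym (Data.List.Properties.map-++ ρ (fvAtom a) (fvStore K)))
    where import Data.List.Properties

  fvGoal-user : (K : Store) → fvGoal (map user K) ≡ fvStore K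
  fvGoal-user []      = refl
  fvGoal-user (a ∷ K) = cong (fvAtom a ++_) (fvGoal-user K)

  users-user : (K : Store) (G : Goal) → users (map user K ++ G) ≡ K ++ users G
  users-user []      G = refl
  users-user (a ∷ K) G = cong (a ∷_) (users-user K G)

  users-map-user : (K : Store) → users (map user K) ≡ K
  users-map-user []      = refl
  users-map-user (a ∷ K) = cong (a ∷_) (users-map-user K)

  builtins-map-user : (K : Store) → builtins (map user K) ≡ []
  builtins-map-user []      = refl
  builtins-map-user (a ∷ K) = builtins-map-user K

  builtins-user : (K : Store) (G : Goal) → builtins (map user K ++ G) ≡ builtins G
  builtins-user []      G = refl
  builtins-user (a ∷ K) G = builtins-user K G

  infix 2 _⇔ᵣ_
  _⇔ᵣ_ : List⁺ (Atom Term) → Store → Rule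
  H ⇔ᵣ B = simplification H [] (map user B)

  ren-user : (ρ : Var → Var) (K : Store) →
    map (renConstraint ρ) (map user K) ≡ map user (map (renAtom ρ) K)
  ren-user ρ K = trans (sym (map-∘ K)) (map-∘ K)

  ∈-fvStore-resp-↭ : {K L : Store} → K ↭ L → {x : Var} → x ∈ fvStore K → x ∈ fvStore L
  ∈-fvStore-resp-↭ {K} {L} K↭L = ∈-concatMap-⊆ fvAtom {K} {L} (↭ₚ.∈-resp-↭ K↭L)

  fvStore-++ : (K L : Store) → fvStore (K ++ L) ≡ fvStore K ++ fvStore L
  fvStore-++ []      L = refl
  fvStore-++ (a ∷ K) L = trans (cong (fvAtom a ++_) (fvStore-++ K L))
    (sym (++-assoc (fvAtom a) (fvStore K) (fvStore L)))

  ∈-fvStore-++⁺ˡ : (K L : Store) {x : Var} → x ∈ fvStore K → x ∈ fvStore (K ++ L)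
  ∈-fvStore-++⁺ˡ K L = ∈-concatMap-⊆ fvAtom {K} {K ++ L} ∈-++⁺ˡ

  users-↭ : {G G′ : Goal} → G ↭ G′ → users G ↭ users G′
  users-↭ _↭_.refl                               = ↭-refl
  users-↭ (_↭_.prep (builtin _) p)               = users-↭ p
  users-↭ (_↭_.prep (user a) p)                  = _↭_.prep a (users-↭ p)
  users-↭ (_↭_.swap (builtin _) (builtin _) p)   = users-↭ p
  users-↭ (_↭_.swap (builtin _) (user b) p)      = _↭_.prep b (users-↭ p)
  users-↭ (_↭_.swap (user a) (builtin _) p)      = _↭_.prep a (users-↭ p)
  users-↭ (_↭_.swap (user a) (user b) p)         = _↭_.swap a b (users-↭ p)
  users-↭ (_↭_.trans p q)                        = ↭-trans (users-↭ p) (users-↭ q)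

  builtins-↭ : {G G′ : Goal} → G ↭ G′ → builtins G ↭ builtins G′
  builtins-↭ _↭_.refl                             = ↭-refl
  builtins-↭ (_↭_.prep (builtin c) p)             = _↭_.prep c (builtins-↭ p)
  builtins-↭ (_↭_.prep (user _) p)                = builtins-↭ p
  builtins-↭ (_↭_.swap (builtin c) (builtin d) p) = _↭_.swap c d (builtins-↭ p)
  builtins-↭ (_↭_.swap (builtin c) (user _) p)    = _↭_.prep c (builtins-↭ p)
  builtins-↭ (_↭_.swap (user _) (builtin d) p)    = _↭_.prep d (builtins-↭ p)
  builtins-↭ (_↭_.swap (user _) (user _) p)       = builtins-↭ p
  builtins-↭ (_↭_.trans p q)                      = ↭-trans (builtins-↭ p) (builtins-↭ q)

  introduce-⊆ : {G G′ : Goal} {K : Store} {h : Atom Term} {d : Builtin} →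
    G ↭ user h ∷ G′ → {x : Var} →
    x ∈ fvConfig ⟨ G , K , d ⟩ → x ∈ fvConfig ⟨ G′ , h ∷ K , d ⟩
  introduce-⊆ {G} {G′} {K} {h} {d} G↭ x∈ with ∈-++⁻ (fvGoal G) x∈
  ... | inj₂ x∈′ = ∈-++⁺ʳ (fvGoal G′) (subst (_ ∈_)
          (sym (++-assoc (fvAtom h) (fvStore K) (fvBuiltin d))) (∈-++⁺ʳ (fvAtom h) x∈′))
  ... | inj₁ x∈G
    with ∈-++⁻ (fvAtom h) (∈-concatMap-⊆ fvConstraint {G} {user h ∷ G′} (↭ₚ.∈-resp-↭ G↭) x∈G)
  ...   | inj₁ x∈h  = ∈-++⁺ʳ (fvGoal G′) (∈-++⁺ˡ (∈-++⁺ˡ x∈h))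
  ...   | inj₂ x∈G′ = ∈-++⁺ˡ x∈G′

  simplify-⊆ : {G : Goal} {K K₀ H H′ : Store} {d e : Builtin} →
    K ↭ H′ ++ K₀ → Equations H H′ e → {x : Var} →
    x ∈ fvConfig ⟨ G , K , d ⟩ → x ∈ fvConfig ⟨ G , K₀ , e ∧ d ⟩
  simplify-⊆ {G} {K} {K₀} {H} {H′} {d} {e} K↭ E x∈ with ∈-++⁻ (fvGoal G) x∈
  ... | inj₁ x∈G = ∈-++⁺ˡ x∈G
  ... | inj₂ x∈′ with ∈-++⁻ (fvStore K) x∈′
  ...   | inj₂ x∈d = ∈-++⁺ʳ (fvGoal G) (∈-++⁺ʳ (fvStore K₀) (∈-++⁺ʳ (fvBuiltin e) x∈d))
  ...   | inj₁ x∈K with ∈-++⁻ (fvStore H′)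
                          (subst (_ ∈_) (fvStore-++ H′ K₀) (∈-fvStore-resp-↭ K↭ x∈K))
  ...     | inj₁ x∈H′ = ∈-++⁺ʳ (fvGoal G) (∈-++⁺ʳ (fvStore K₀) (∈-++⁺ˡ (Equations-fvʳ E x∈H′)))
  ...     | inj₂ x∈K₀ = ∈-++⁺ʳ (fvGoal G) (∈-++⁺ˡ x∈K₀)

  body-⊆ : {G : Goal} {K : Store} {d : Builtin} (B : Goal) {x : Var} →
    x ∈ fvConfig ⟨ G , K , d ⟩ → x ∈ fvConfig ⟨ B ++ G , K , d ⟩
  body-⊆ {G} B x∈ with ∈-++⁻ (fvGoal G) x∈
  ... | inj₁ x∈G = ∈-++⁺ˡ (∈-concatMap-⊆ fvConstraint {G} {B ++ G} (∈-++⁺ʳ B) x∈G)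
  ... | inj₂ x∈′ = ∈-++⁺ʳ (fvGoal (B ++ G)) x∈′

  -- Under `e` the renamed head `H` equals the consumed atoms `H′` and can replace them, so that the
  -- variables of the rule itself can be matched with the encoding.
  simplify-↭ : {K K₀ H H′ L U : Store} {d e : Builtin} →
    K ↭ H′ ++ K₀ → Equations H H′ e → d ⊢ U ++ K ↭ L → e ∧ d ⊢ H ++ U ++ K₀ ↭ L
  simplify-↭ {H′ = H′} {U = U} {d} {e} K↭ E UK↭L = Homogeneous.trans
    (↭ᵈ.++⁺ʳ {e ∧ d} (U ++ _) (Homogeneous.refl (Equations-sound E)))
    (Homogeneous.trans
      (fromPropositional {e ∧ d} (↭-trans (↭ₚ.shifts H′ U) (↭ₚ.++⁺ˡ U (↭-sym K↭))))
      (weaken {e} {d} UK↭L))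

  -- Fresh variants of rules and enabled Simplify steps.

  beyond : List Var → Var → Var
  beyond W x = suc (max 0 W) + x

  beyond-injective : (W : List Var) → Injective _≡_ _≡_ (beyond W)
  beyond-injective W = +-cancelˡ-≡ (suc (max 0 W)) _ _

  beyond-fresh : (W : List Var) {x : Var} → beyond W x ∉ W
  beyond-fresh W {x} ρx∈W =
    <-irrefl refl (≤-trans (m≤m+n _ x) (All.lookup (xs≤max 0 W) ρx∈W))

  -- Here `θ` presents the match as a substitution for the variables of the head. The guard holds
  -- because each renamed head variable can take the value of the corresponding image under `θ`.
  simplify-enabled : {P : Program} {V : List Var} {G : Goal} {K L : Store} {d : Builtin}
    {H : List⁺ (Atom Term)} {B : Store} (θ : Var → Var) →
    (H ⇔ᵣ B) ∈ P → Unconstrained d (_∈ []) →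
    d ⊢ K ↭ map (renAtom θ) (List⁺.toList H) ++ L →
    ∃[ γ ] P ∣ V ⊢ ⟨ G , K , d ⟩ ⟶ γ
  simplify-enabled {P} {V} {G} {K} {L} {d} {H} {B} θ r∈P sat K↭
    with permute-pointwise (≋.trans d) (Pointwise.refl (≋.refl d)) K↭
  ... | _ , K↭zs , zs≋ with pointwise-split (map (renAtom θ) (List⁺.toList H)) zs≋
  ... | H′ , K₀ , refl , H′≋θH = _ , simplify K↭zs
      ((_ , ρ , r∈P , beyond-injective W , refl) , fresh) E guard
    where
    W  = V ++ fvConfig ⟨ G , K , d ⟩
    ρ  = beyond W
    hd = List⁺.toList H

    fresh : Disjoint (fvRule (renRule ρ (H ⇔ᵣ B))) W
    fresh {x} (x∈r , x∈W) with ∈-++⁻ (fvStore (map (renAtom ρ) hd)) x∈r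
    ... | inj₁ x∈H with ∈-map⁻ ρ (subst (x ∈_) (fvStore-ren ρ hd) x∈H)
    ...   | _ , _ , refl = beyond-fresh W x∈W
    fresh {x} (x∈r , x∈W) | inj₂ x∈B
      with ∈-map⁻ ρ (subst (x ∈_) (trans (cong fvGoal (ren-user ρ B))
             (trans (fvGoal-user (map (renAtom ρ) B)) (fvStore-ren ρ B))) x∈B)
    ... | _ , _ , refl = beyond-fresh W x∈W

    H′⊆W : ∀ {x} → x ∈ fvStore H′ → x ∈ W
    H′⊆W x∈H′ = ∈-++⁺ʳ V (∈-++⁺ʳ (fvGoal G) (∈-++⁺ˡ
      (∈-fvStore-resp-↭ (↭-sym K↭zs) (∈-fvStore-++⁺ˡ H′ K₀ x∈H′))))

    -- Atoms equal modulo `d` are known to share their predicate symbol because `d` has a solution,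
    -- here one in `generic`.
    samePred : ∀ as {bs} → Pointwise (d ⊢_≋_) bs (map (renAtom θ) as) →
      Pointwise (λ a b → pred a ≡ pred b) (map (renAtom ρ) as) bs
    samePred []       []         = []
    samePred (a ∷ as) {b ∷ _} (b≋ ∷ p) = eq ∷ samePred as p
      where
      eq : pred (renAtom ρ a) ≡ pred b
      eq with sat generic generic-valuation
      ... | τ , h , _ = trans (pred-mapAtom _ a) (sym (trans (sym (pred-mapAtom _ b))
              (trans (cong pred (b≋ generic τ h))
              (trans (pred-mapAtom _ (renAtom θ a)) (pred-mapAtom _ a)))))

    E = proj₂ (Equations-exist (samePred hd H′≋θH))

    guard : CT⊨ d ⟶ exs (fvStore (map (renAtom ρ) hd)) (_ ∧ true)
    guard 𝓜 τ h = exs-intro 𝓜 ys {τ = τ′} (sym ∘ outside)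
      (Equations-complete E 𝓜 (matches hd inside H′≋θH
        (λ x∈H′ → outside λ x∈ys → fresh (∈-++⁺ˡ x∈ys , H′⊆W x∈H′))) , tt)
      where
      ys = fvStore (map (renAtom ρ) hd)

      -- The renaming `ρ` is a shift by `suc (max 0 W)`, so subtraction recovers the original rule
      -- variable, which then receives the value of its image under `θ`.
      τ′ : Valuation 𝓜
      τ′ y = if does (y ∈? ys) then τ (θ (y ∸ suc (max 0 W))) else τ y

      outside : ∀ {y} → y ∉ ys → τ′ y ≡ τ y
      outside {y} y∉ys rewrite dec-false (y ∈? ys) y∉ys = refl

      inside : ∀ {x} → x ∈ fvStore hd → τ′ (ρ x) ≡ τ (θ x)
      inside {x} x∈
        rewrite dec-true (ρ x ∈? ys) (subst (ρ x ∈_) (sym (fvStore-ren ρ hd)) (∈-map⁺ ρ x∈))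
              | m+n∸m≡n (max 0 W) x = refl

      matches : ∀ as {bs} → (∀ {x} → x ∈ fvStore as → τ′ (ρ x) ≡ τ (θ x)) →
        Pointwise (d ⊢_≋_) bs (map (renAtom θ) as) →
        (∀ {x} → x ∈ fvStore bs → τ′ x ≡ τ x) →
        Pointwise (λ a b → mapAtom (value 𝓜 τ′) a ≡ mapAtom (value 𝓜 τ′) b)
          (map (renAtom ρ) as) bs
      matches []       _  []       _   = []
      matches (a ∷ as) {b ∷ bs} in′ (b≋ ∷ p) out =
        trans (value-renAtom 𝓜 τ′ ρ a)
          (trans (atom-cong 𝓜 a (in′ ∘ ∈-++⁺ˡ))
          (trans (sym (value-renAtom 𝓜 τ θ a))
          (trans (sym (b≋ 𝓜 τ h)) (sym (atom-cong 𝓜 b (out ∘ ∈-++⁺ˡ))))))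
        ∷ matches as (in′ ∘ ∈-++⁺ʳ (fvAtom a)) p (out ∘ ∈-++⁺ʳ (fvAtom b))

-- Register updates and machine steps.

infixl 9 _[_≔_]
_[_≔_] : {A : Set} → (Reg → A) → Reg → A → Reg → A
(f [ r₁ ≔ x ]) r₁ = x
(f [ r₁ ≔ x ]) r₂ = f r₂
(f [ r₂ ≔ x ]) r₁ = f r₁
(f [ r₂ ≔ x ]) r₂ = x

lengths-≔ : {A : Set} {X : Reg → List A} {v : Registers} {xs : List A} {k : ℕ} (r : Reg) →
  (∀ q → length (X q) ≡ get q v) → length xs ≡ k →
  ∀ q → length ((X [ r ≔ xs ]) q) ≡ get q (set r k v)
lengths-≔ r₁ lengths eq r₁ = eq
lengths-≔ r₁ lengths eq r₂ = lengths r₂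
lengths-≔ r₂ lengths eq r₁ = lengths r₁
lengths-≔ r₂ lengths eq r₂ = eq

↝-deterministic : {n : ℕ} {M : Machine n} {s s′ s″ : State n} →
  M ⊢ s ↝ s′ → M ⊢ s ↝ s″ → s′ ≡ s″
↝-deterministic (succ p)   (succ q)   with refl ← trans (sym p) q = refl
↝-deterministic (succ p)   (dec q _)  with () ← trans (sym p) q
↝-deterministic (succ p)   (jump q _) with () ← trans (sym p) q
↝-deterministic (dec p _)  (succ q)   with () ← trans (sym p) q
↝-deterministic (dec p x)  (dec q y)  with refl ← trans (sym p) q
  with refl ← trans (sym x) y = refl
↝-deterministic (dec p x)  (jump q y) with refl ← trans (sym p) q
  with () ← trans (sym x) y
↝-deterministic (jump p _) (succ q)   with () ← trans (sym p) q
↝-deterministic (jump p x) (dec q y)  with refl ← trans (sym p) q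
  with () ← trans (sym x) y
↝-deterministic (jump p _) (jump q _) with refl ← trans (sym p) q = refl

halt-stuck : {n : ℕ} {M : Machine n} {j : Fin n} {v : Registers} {s : State n} →
  M j ≡ halt → ¬ (M ⊢ (j , v) ↝ s)
halt-stuck p (succ q)   with () ← trans (sym p) q
halt-stuck p (dec q _)  with () ← trans (sym p) q
halt-stuck p (jump q _) with () ← trans (sym p) q

-- Every `succ` and `decJump` carries a proof that its successor position exists, so such an
-- instruction always has a next state.
stuck-halt : {n : ℕ} {M : Machine n} {j : Fin n} {v : Registers} →
  (∀ {s} → ¬ (M ⊢ (j , v) ↝ s)) → M j ≡ halt
stuck-halt {M = M} {j} {v} stuck with M j in eq
... | halt          = refl
... | succ r _      = ⊥-elim (stuck (succ eq))
... | decJump r l _ with get r v in eq′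
...   | zero  = ⊥-elim (stuck (jump eq eq′))
...   | suc _ = ⊥-elim (stuck (dec eq eq′))

-- The rules of the encoding.

module Simulation (n e : ℕ) (M : Machine (suc n)) where

  open Encoding (suc n) e
  open CHRProperties (Fin (suc n) ⊎ Fin e) TCMPred tcmArity

  iAtom : Fin (suc n) → (Reg → Var) → Atom Term
  iAtom j f = i⟨ j , f r₁ , f r₂ ⟩

  regVar succVar preVar : Reg → Var
  regVar r₁ = R₁
  regVar r₂ = R₂
  succVar r₁ = SuccR₁
  succVar r₂ = SuccR₂
  preVar r₁ = PreR₁
  preVar r₂ = PreR₂

  -- Merges the clauses for the two registers, so that each kind of rule is treated once, for an
  -- arbitrary `r`.
  data InstrRule : Rule → Set where
    succ : ∀ {j r j+1<n} → M j ≡ succ r j+1<n → InstrRule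
      (iAtom j regVar ∷ [] ⇔ᵣ
        s⟨ regVar r , succVar r ⟩ ∷ iAtom (fromℕ< j+1<n) (regVar [ r ≔ succVar r ]) ∷ [])
    dec : ∀ {j r l j+1<n} → M j ≡ decJump r l j+1<n → InstrRule
      (iAtom j regVar ∷ s⟨ preVar r , regVar r ⟩ ∷ [] ⇔ᵣ
        iAtom (fromℕ< j+1<n) (regVar [ r ≔ preVar r ]) ∷ [])
    jump : ∀ {j r l j+1<n} → M j ≡ decJump r l j+1<n → InstrRule
      (zero⟨ regVar r ⟩ ∷ iAtom j regVar ∷ [] ⇔ᵣ
        iAtom l regVar ∷ zero⟨ regVar r ⟩ ∷ [])

  ∈⇒InstrRule : {r : Rule} → r ∈ ⟦ M ⟧₂ → InstrRule r
  ∈⇒InstrRule r∈ with find (∈-concatMap⁻ _ {xs = allFin (suc n)} r∈)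
  ... | j , _ , r∈j = cases (M j) refl r∈j
    where
    cases : ∀ ι → M j ≡ ι → ∀ {r} → r ∈ encodeInstr j ι → InstrRule r
    cases (succ r₁ _)      eq (here refl)         = succ eq
    cases (succ r₂ _)      eq (here refl)         = succ eq
    cases (decJump r₁ _ _) eq (here refl)         = dec eq
    cases (decJump r₂ _ _) eq (here refl)         = dec eq
    cases (decJump r₁ _ _) eq (there (here refl)) = jump eq
    cases (decJump r₂ _ _) eq (there (here refl)) = jump eq

  InstrRule⇒∈ : {r : Rule} → InstrRule r → r ∈ ⟦ M ⟧₂
  InstrRule⇒∈ ι = ∈-concatMap⁺ _ (lose (∈-allFin (proj₁ (at ι))) (proj₂ (at ι)))
    where
    via : ∀ {r j} {ι : Instr (suc n) j} → M j ≡ ι → r ∈ encodeInstr j ι →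
      ∃[ j ] r ∈ encodeInstr j (M j)
    via {r} {j} eq r∈ = j , subst (λ ι → r ∈ encodeInstr j ι) (sym eq) r∈

    at : ∀ {r} → InstrRule r → ∃[ j ] r ∈ encodeInstr j (M j)
    at (succ {r = r₁} eq) = via eq (here refl)
    at (succ {r = r₂} eq) = via eq (here refl)
    at (dec {r = r₁} eq)  = via eq (here refl)
    at (dec {r = r₂} eq)  = via eq (here refl)
    at (jump {r = r₁} eq) = via eq (there (here refl))
    at (jump {r = r₂} eq) = via eq (there (here refl))

  -- Chains of links and the encoding of machine states.

  -- The variables of a chain above its bottom b are listed from the top.

  topOf : Var → List Var → Var
  topOf b []      = b
  topOf b (x ∷ _) = x

  chain : Var → List Var → Store
  chain b []       = zero⟨ b ⟩ ∷ []
  chain b (x ∷ xs) = s⟨ topOf b xs , x ⟩ ∷ chain b xs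

  top : (Reg → List Var) → Reg → Var
  top X r = topOf (regVar r) (X r)

  -- This is not the order of the chain: the bottom comes first, then the other variables from the
  -- top down.
  stack : (Reg → List Var) → Reg → List Var
  stack X r = regVar r ∷ X r

  chains : (Reg → List Var) → Store
  chains X = chain R₁ (X r₁) ++ chain R₂ (X r₂)

  encoding : Fin (suc n) → (Reg → List Var) → Store
  encoding j X = iAtom j (top X) ∷ chains X

  Live : (Reg → List Var) → Var → Set
  Live X x = ∃[ r ] x ∈ stack X r

  record Distinct (X : Reg → List Var) : Set where
    field
      unique   : ∀ r → Unique (stack X r)
      separate : ∀ {r q x} → x ∈ stack X r → x ∈ stack X q → r ≡ q

  open Distinct

  topOf-∈ : (b : Var) (xs : List Var) → topOf b xs ∈ b ∷ xs
  topOf-∈ b []      = here refl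
  topOf-∈ b (_ ∷ _) = there (here refl)

  fv-chain : (b : Var) (xs : List Var) {x : Var} → x ∈ fvStore (chain b xs) → x ∈ b ∷ xs
  fv-chain b []       (here refl)         = here refl
  fv-chain b (y ∷ xs) (there (here refl)) = there (here refl)
  fv-chain b (y ∷ xs) (here refl)         with topOf-∈ b xs
  ... | here eq = here eq
  ... | there m = there (there m)
  fv-chain b (y ∷ xs) (there (there x∈))  with fv-chain b xs x∈
  ... | here eq = here eq
  ... | there m = there (there m)

  fv-encoding : (j : Fin (suc n)) (X : Reg → List Var) {x : Var} →
    x ∈ fvStore (encoding j X) → Live X x
  fv-encoding j X (here refl)         = r₁ , topOf-∈ R₁ (X r₁)
  fv-encoding j X (there (here refl)) = r₂ , topOf-∈ R₂ (X r₂)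
  fv-encoding j X (there (there x∈))
    with ∈-++⁻ (fvStore (chain R₁ (X r₁)))
           (subst (_ ∈_) (fvStore-++ (chain R₁ (X r₁)) (chain R₂ (X r₂))) x∈)
  ... | inj₁ x∈₁ = r₁ , fv-chain R₁ (X r₁) x∈₁
  ... | inj₂ x∈₂ = r₂ , fv-chain R₂ (X r₂) x∈₂

  stack-push : {X : Reg → List Var} {x y : Var} (r q : Reg) →
    y ∈ stack (X [ r ≔ x ∷ X r ]) q → (y ≡ x × q ≡ r) ⊎ y ∈ stack X q
  stack-push r₁ r₁ (here eq)         = inj₂ (here eq)
  stack-push r₁ r₁ (there (here eq)) = inj₁ (eq , refl)
  stack-push r₁ r₁ (there (there m)) = inj₂ (there m)
  stack-push r₁ r₂ m                 = inj₂ m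
  stack-push r₂ r₁ m                 = inj₂ m
  stack-push r₂ r₂ (here eq)         = inj₂ (here eq)
  stack-push r₂ r₂ (there (here eq)) = inj₁ (eq , refl)
  stack-push r₂ r₂ (there (there m)) = inj₂ (there m)

  stack-pop : {X : Reg → List Var} {x y : Var} {xs : List Var} (r q : Reg) →
    X r ≡ x ∷ xs → y ∈ stack (X [ r ≔ xs ]) q → y ∈ stack X q
  stack-pop r₁ r₁ eq (here eq′) = here eq′
  stack-pop r₁ r₁ eq (there m)  = there (subst (_ ∈_) (sym eq) (there m))
  stack-pop r₁ r₂ eq m          = m
  stack-pop r₂ r₁ eq m          = m
  stack-pop r₂ r₂ eq (here eq′) = here eq′
  stack-pop r₂ r₂ eq (there m)  = there (subst (_ ∈_) (sym eq) (there m))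

  unique-push : {b x : Var} {xs : List Var} →
    x ∉ b ∷ xs → Unique (b ∷ xs) → Unique (b ∷ x ∷ xs)
  unique-push x∉ (b# ∷ u) =
    ((λ b≡x → x∉ (here (sym b≡x))) ∷ b#) ∷
    (All.tabulate (λ y∈ x≡y → x∉ (there (subst (_∈ _) (sym x≡y) y∈)))) ∷ u

  unique-pop : {b x : Var} {xs : List Var} → Unique (b ∷ x ∷ xs) → Unique (b ∷ xs)
  unique-pop ((_ ∷ b#) ∷ (_ ∷ u)) = b# ∷ u

  distinct-push : {X : Reg → List Var} {x : Var} (r : Reg) → ¬ Live X x →
    Distinct X → Distinct (X [ r ≔ x ∷ X r ])
  distinct-push {X} {x} r x∉ D = record { unique = unique′ r ; separate = separate′ }
    where
    unique′ : ∀ r q → Unique (stack (X [ r ≔ x ∷ X r ]) q)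
    unique′ r₁ r₁ = unique-push (λ m → x∉ (r₁ , m)) (unique D r₁)
    unique′ r₁ r₂ = unique D r₂
    unique′ r₂ r₁ = unique D r₁
    unique′ r₂ r₂ = unique-push (λ m → x∉ (r₂ , m)) (unique D r₂)

    separate′ : ∀ {p q y} → y ∈ stack (X [ r ≔ x ∷ X r ]) p →
      y ∈ stack (X [ r ≔ x ∷ X r ]) q → p ≡ q
    separate′ {p} {q} m m′ with stack-push r p m | stack-push r q m′
    ... | inj₁ (_ , refl) | inj₁ (_ , refl) = refl
    ... | inj₁ (refl , _) | inj₂ k          = ⊥-elim (x∉ (q , k))
    ... | inj₂ k          | inj₁ (refl , _) = ⊥-elim (x∉ (p , k))
    ... | inj₂ k          | inj₂ k′         = separate D k k′

  distinct-pop : {X : Reg → List Var} {x : Var} {xs : List Var} (r : Reg) → X r ≡ x ∷ xs →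
    Distinct X → Distinct (X [ r ≔ xs ])
  distinct-pop {X} {x} {xs} r eq D = record
    { unique   = unique′ r eq
    ; separate = λ {p} {q} m m′ → separate D (stack-pop r p eq m) (stack-pop r q eq m′)
    }
    where
    unique′ : ∀ r → X r ≡ x ∷ xs → ∀ q → Unique (stack (X [ r ≔ xs ]) q)
    unique′ r₁ eq r₁ = unique-pop (subst (λ ys → Unique (R₁ ∷ ys)) eq (unique D r₁))
    unique′ r₁ eq r₂ = unique D r₂
    unique′ r₂ eq r₁ = unique D r₁
    unique′ r₂ eq r₂ = unique-pop (subst (λ ys → Unique (R₂ ∷ ys)) eq (unique D r₂))

  chains-push : (X : Reg → List Var) (r : Reg) (x : Var) →
    s⟨ top X r , x ⟩ ∷ chains X ↭ chains (X [ r ≔ x ∷ X r ])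
  chains-push X r₁ x = ↭-refl
  chains-push X r₂ x = ↭-sym (↭ₚ.shift _ (chain R₁ (X r₁)) (chain R₂ (X r₂)))

  chains-pop : {X : Reg → List Var} {x : Var} {xs : List Var} (r : Reg) → X r ≡ x ∷ xs →
    chains X ↭ s⟨ topOf (regVar r) xs , x ⟩ ∷ chains (X [ r ≔ xs ])
  chains-pop {X} r₁ eq rewrite eq = ↭-refl
  chains-pop {X} r₂ eq rewrite eq = ↭ₚ.shift _ (chain R₁ (X r₁)) _

  -- Locating an atom in the chains.

  module _ {ℓ : Level} {Q : Atom Term → Set ℓ} where

    any-chain : {b : Var} (xs : List Var) → Any Q (chain b xs) →
      Q zero⟨ b ⟩ ⊎ (∃[ z ] ∃[ y ] y ∈ xs × Q s⟨ z , y ⟩)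
    any-chain []       (here q)  = inj₁ q
    any-chain (x ∷ xs) (here q)  = inj₂ (_ , x , here refl , q)
    any-chain (x ∷ xs) (there m) with any-chain xs m
    ... | inj₁ q                = inj₁ q
    ... | inj₂ (z , y , y∈ , q) = inj₂ (z , y , there y∈ , q)

    any-chains : (X : Reg → List Var) → Any Q (chains X) →
      ∃[ r ] Any Q (chain (regVar r) (X r))
    any-chains X m with Anyₚ.++⁻ (chain R₁ (X r₁)) m
    ... | inj₁ m₁ = r₁ , m₁
    ... | inj₂ m₂ = r₂ , m₂

    -- A live variable is the second argument of at most one link. Hence `separate` confines the
    -- search to the chain of `r`, and `Unique` to its first link, since a lower link ending in the
    -- top would repeat that variable.
    find-s : {X : Reg → List Var} → Distinct X → (r : Reg) → (∀ {z} → ¬ Q zero⟨ z ⟩) →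
      (∀ {z y} → Live X y → Q s⟨ z , y ⟩ → y ≡ top X r) → Any Q (chains X) →
      ∃[ x ] ∃[ xs ] X r ≡ x ∷ xs × Q s⟨ topOf (regVar r) xs , x ⟩
    find-s {X} D r no-zero only-top m with any-chains X m
    ... | q , m′ with any-chain (X q) m′
    ...   | inj₁ z = ⊥-elim (no-zero z)
    ...   | inj₂ (z , y , y∈ , sy)
      with refl ← separate D (subst (_∈ stack X q) (only-top (q , there y∈) sy) (there y∈))
                    (topOf-∈ (regVar r) (X r))
      = first (X r) (unique D r) (λ y∈ → only-top (r , there y∈)) m′
      where
      first : ∀ ys → Unique (regVar r ∷ ys) →
        (∀ {z y} → y ∈ ys → Q s⟨ z , y ⟩ → y ≡ topOf (regVar r) ys) →
        Any Q (chain (regVar r) ys) →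
        ∃[ x ] ∃[ xs ] ys ≡ x ∷ xs × Q s⟨ topOf (regVar r) xs , x ⟩
      first []       _       _    (here z)  = ⊥-elim (no-zero z)
      first (x ∷ xs) _       _    (here sx) = x , xs , refl , sx
      first (x ∷ xs) (_ ∷ u) only (there k) with any-chain xs k
      ... | inj₁ z = ⊥-elim (no-zero z)
      ... | inj₂ (_ , y , y∈ , sy) = ⊥-elim (Unique[x∷xs]⇒x∉xs u
              (subst (_∈ xs) (only (there y∈) sy) y∈))

    -- The bottom that is found coincides with the top of the chain of `r`. So it is the bottom of
    -- this very chain, and a variable above it would make the bottom occur twice.
    find-zero : {X : Reg → List Var} → Distinct X → (r : Reg) → (∀ {z y} → ¬ Q s⟨ z , y ⟩) →
      (∀ {z} → Live X z → Q zero⟨ z ⟩ → z ≡ top X r) → Any Q (chains X) → X r ≡ []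
    find-zero {X} D r no-s only-top m with any-chains X m
    ... | q , m′ with any-chain (X q) m′
    ...   | inj₂ (_ , _ , _ , sy) = ⊥-elim (no-s sy)
    ...   | inj₁ z = bottom-top (only-top (q , here refl) z)
      where
      bottom-top : regVar q ≡ top X r → X r ≡ []
      bottom-top eq with refl ← separate D (here (sym eq)) (topOf-∈ (regVar r) (X r))
        with X r | unique D r
      ... | []    | _ = refl
      ... | _ ∷ _ | u = ⊥-elim (Unique[x∷xs]⇒x∉xs u (here eq))

  -- Matching rule heads with an encoding.

  Separating : (Reg → List Var) → Valuation generic → Set
  Separating X τ = ∀ {x} → Live X x → τ x ≡ inj₂ x

  separating-injective : {X : Reg → List Var} {τ : Valuation generic} → Separating X τ →
    ∀ {x y} → Live X x → Live X y → τ x ≡ τ y → x ≡ y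
  separating-injective sep x∈ y∈ eq
    with refl ← trans (sym (sep x∈)) (trans eq (sep y∈)) = refl

  top-live : (X : Reg → List Var) (r : Reg) → Live X (top X r)
  top-live X r = r , topOf-∈ (regVar r) (X r)

  i-injective : {D : Set} {a a′ x x′ y y′ : D} →
    _≡_ {A = Atom D} (iₚ $ (a ∷ x ∷ y ∷ [])) (iₚ $ (a′ ∷ x′ ∷ y′ ∷ [])) →
    a ≡ a′ × x ≡ x′ × y ≡ y′
  i-injective refl = refl , refl , refl

  s-injective : {D : Set} {x x′ y y′ : D} →
    _≡_ {A = Atom D} (sₚ $ (x ∷ y ∷ [])) (sₚ $ (x′ ∷ y′ ∷ [])) → x ≡ x′ × y ≡ y′
  s-injective refl = refl , refl

  zero-injective : {D : Set} {x x′ : D} →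
    _≡_ {A = Atom D} (zeroₚ $ (x ∷ [])) (zeroₚ $ (x′ ∷ [])) → x ≡ x′
  zero-injective refl = refl

  infix 3 _⊢_≃_
  _⊢_≃_ : Builtin → Var → Var → Set₁
  d ⊢ x ≃ y = CT⊨ d ⟶ var x ≐ var y

  iAtom-cong : {d : Builtin} {j : Fin (suc n)} {f g : Reg → Var} →
    (∀ r → d ⊢ f r ≃ g r) → d ⊢ iAtom j f ≋ iAtom j g
  iAtom-cong f≃g 𝓜 σ h =
    cong₂ (λ x y → iₚ $ (_ ∷ x ∷ y ∷ [])) (f≃g r₁ 𝓜 σ h) (f≃g r₂ 𝓜 σ h)

  ≃-≔ : {d : Builtin} {f g : Reg → Var} {x y : Var} (r : Reg) → (∀ q → d ⊢ f q ≃ g q) →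
    d ⊢ x ≃ y → ∀ q → d ⊢ (f [ r ≔ x ]) q ≃ (g [ r ≔ y ]) q
  ≃-≔ r₁ f≃g x≃y r₁ = x≃y
  ≃-≔ r₁ f≃g x≃y r₂ = f≃g r₂
  ≃-≔ r₂ f≃g x≃y r₁ = f≃g r₁
  ≃-≔ r₂ f≃g x≃y r₂ = x≃y

  ∘-≔ : {A B : Set} (h : A → B) {f : Reg → A} {g : Reg → B} {x : A} (r : Reg) →
    (∀ q → h (f q) ≡ g q) → ∀ q → h ((f [ r ≔ x ]) q) ≡ (g [ r ≔ h x ]) q
  ∘-≔ h r₁ eq r₁ = refl
  ∘-≔ h r₁ eq r₂ = eq r₂
  ∘-≔ h r₂ eq r₁ = eq r₁
  ∘-≔ h r₂ eq r₂ = refl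

  top-≔ : (X : Reg → List Var) (r : Reg) (xs : List Var) →
    ∀ q → top (X [ r ≔ xs ]) q ≡ (top X [ r ≔ topOf (regVar r) xs ]) q
  top-≔ X r₁ xs r₁ = refl
  top-≔ X r₁ xs r₂ = refl
  top-≔ X r₂ xs r₁ = refl
  top-≔ X r₂ xs r₂ = refl

  iAtom-≔ : {d : Builtin} {j : Fin (suc n)} {X : Reg → List Var} {xs : List Var}
    (ρ : Var → Var) {z : Var} (r : Reg) → (∀ q → d ⊢ ρ (regVar q) ≃ top X q) →
    d ⊢ ρ z ≃ topOf (regVar r) xs →
    d ⊢ iAtom j (ρ ∘ (regVar [ r ≔ z ])) ≋ iAtom j (top (X [ r ≔ xs ]))
  iAtom-≔ {d} {X = X} {xs} ρ r heads≃ z≃ = iAtom-cong λ q → subst₂ (d ⊢_≃_)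
    (sym (∘-≔ ρ r (λ _ → refl) q)) (sym (top-≔ X r xs q)) (≃-≔ r heads≃ z≃ q)

  -- An encoding has a single atom with predicate `iₚ`. A solution of `d` in `generic` rules out the
  -- other predicates and, constants denoting distinct elements, identifies the positions.
  match-i : {d : Builtin} {X : Reg → List Var} {j j′ : Fin (suc n)} {f : Reg → Var}
    {L : Store} →
    Unconstrained d (Live X) → d ⊢ iAtom j′ f ∷ L ↭ encoding j X →
    j′ ≡ j × (∀ r → d ⊢ f r ≃ top X r) × d ⊢ L ↭ chains X
  match-i {d} {X} {j} {j′} {f} {L} free p
    with free generic generic-valuation | head-≋ p
  ... | τ , h , _ | here i≋ = j≡ (i-injective (i≋ generic τ h)) , f≃ ,
          cancel-≋ {d} {iAtom j′ f} i≋ p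
    where
    j≡ : ∀ {x x′ y y′} → inj₁ (inj₁ j′) ≡ inj₁ (inj₁ j) × x ≡ x′ × y ≡ y′ → j′ ≡ j
    j≡ (refl , _) = refl

    f≃ : ∀ r → d ⊢ f r ≃ top X r
    f≃ r₁ 𝓜 σ k = proj₁ (proj₂ (i-injective (i≋ 𝓜 σ k)))
    f≃ r₂ 𝓜 σ k = proj₂ (proj₂ (i-injective (i≋ 𝓜 σ k)))
  ... | τ , h , _ | there m with any-chains X m
  ...   | r , m′ with any-chain (X r) m′
  ...     | inj₁ i≋z           with () ← i≋z generic τ h
  ...     | inj₂ (_ , _ , _ , i≋s) with () ← i≋s generic τ h

  -- The solution in `generic` only locates the matched link. The equality of arguments then holds
  -- in every model, because the permutation is one modulo `d`.
  match-s : {d : Builtin} {X : Reg → List Var} {x y : Var} {L : Store} (r : Reg) →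
    Unconstrained d (Live X) → Distinct X → d ⊢ y ≃ top X r → d ⊢ s⟨ x , y ⟩ ∷ L ↭ chains X →
    ∃[ z ] ∃[ zs ] X r ≡ z ∷ zs × d ⊢ x ≃ topOf (regVar r) zs × d ⊢ L ↭ chains (X [ r ≔ zs ])
  match-s {d} {X} {x} {y} r free D y≃ p with free generic generic-valuation
  ... | τ , h , sep
    with find-s {Q = d ⊢ s⟨ x , y ⟩ ≋_} D r
           (λ s≋z → contradiction (s≋z generic τ h) λ ())
           (λ z∈ s≋ → separating-injective sep z∈ (top-live X r)
             (trans (sym (proj₂ (s-injective (s≋ generic τ h)))) (y≃ generic τ h)))
           (head-≋ p)
  ... | z , zs , eq , s≋ = z , zs , eq ,
    (λ 𝓜 σ k → proj₁ (s-injective (s≋ 𝓜 σ k))) ,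
    cancel-≋ {d} {s⟨ x , y ⟩} s≋ (Homogeneous.trans p (fromPropositional {d} (chains-pop r eq)))

  match-zero : {d : Builtin} {X : Reg → List Var} {y : Var} {L : Store} (r : Reg) →
    Unconstrained d (Live X) → Distinct X → d ⊢ y ≃ top X r → d ⊢ zero⟨ y ⟩ ∷ L ↭ chains X →
    X r ≡ []
  match-zero {d} {X} {y} r free D y≃ p with free generic generic-valuation
  ... | τ , h , sep = find-zero {Q = d ⊢ zero⟨ y ⟩ ≋_} D r
           (λ z≋s → contradiction (z≋s generic τ h) λ ())
           (λ z∈ z≋ → separating-injective sep z∈ (top-live X r)
             (trans (sym (zero-injective (z≋ generic τ h))) (y≃ generic τ h)))
           (head-≋ p)

  -- The invariant of runs and its preservation.

  V : List Var
  V = fvGoal (initialGoal zero)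

  -- H holds the heads consumed by a rule whose body has not been added to the goal yet,
  -- so that H = [] for the configurations of a run.  The field inside makes the variables
  -- of renamed rules differ from the chain variables.
  record Encodes (H : Store) (γ : Config) (s : State (suc n)) : Set₁ where
    open Config γ
    field
      vars     : Reg → List Var
      distinct : Distinct vars
      lengths  : ∀ r → length (vars r) ≡ get r (proj₂ s)
      inside   : ∀ {x} → Live vars x → x ∈ V ++ fvConfig γ
      pure     : builtins goal ≡ []
      free     : Unconstrained built (Live vars)
      atoms    : built ⊢ H ++ users goal ++ store ↭ encoding (proj₁ s) vars

  V-⊆ : {γ γ′ : Config} → (∀ {x} → x ∈ fvConfig γ → x ∈ fvConfig γ′) →
    ∀ {x} → x ∈ V ++ fvConfig γ → x ∈ V ++ fvConfig γ′
  V-⊆ γ⊆γ′ x∈ with ∈-++⁻ V x∈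
  ... | inj₁ x∈V = ∈-++⁺ˡ x∈V
  ... | inj₂ x∈γ = ∈-++⁺ʳ V (γ⊆γ′ x∈γ)

  initial : Encodes [] ⟨ initialGoal zero , [] , true ⟩ (zero , 0 , 0)
  initial = record
    { vars     = λ _ → []
    ; distinct = record { unique = λ _ → [] ∷ [] ; separate = λ { {r} {q} → separate′ r q } }
    ; lengths  = λ { r₁ → refl ; r₂ → refl }
    ; inside   = λ { (r₁ , here refl) → here refl ; (r₂ , here refl) → there (here refl) }
    ; pure     = refl
    ; free     = λ 𝓜 σ → σ , tt , λ _ → refl
    ; atoms    = fromPropositional (↭ₚ.shift _ (zero⟨ R₁ ⟩ ∷ zero⟨ R₂ ⟩ ∷ []) [])
    }
    where
    separate′ : ∀ r q {x} → x ∈ regVar r ∷ [] → x ∈ regVar q ∷ [] → r ≡ q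
    separate′ r₁ r₁ _           _         = refl
    separate′ r₁ r₂ (here refl) (here ())
    separate′ r₂ r₁ (here refl) (here ())
    separate′ r₂ r₂ _           _         = refl

  introduce-encodes : {G G′ : Goal} {K : Store} {h : Atom Term} {d : Builtin}
    {s : State (suc n)} →
    G ↭ user h ∷ G′ → Encodes [] ⟨ G , K , d ⟩ s → Encodes [] ⟨ G′ , h ∷ K , d ⟩ s
  introduce-encodes {G} {G′} {K} {h} {d} G↭ I = record
    { vars     = vars
    ; distinct = distinct
    ; lengths  = lengths
    ; inside   = V-⊆ {⟨ G , K , d ⟩} {⟨ G′ , h ∷ K , d ⟩}
                   (introduce-⊆ {G} {G′} {K} {h} {d} G↭) ∘ inside
    ; pure     = ↭ₚ.↭-empty-inv (subst (_ ↭_) pure (builtins-↭ (↭-sym G↭)))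
    ; free     = free
    ; atoms    = Homogeneous.trans (fromPropositional {d} (↭-trans (↭ₚ.shift h (users G′) K)
                   (↭ₚ.++⁺ʳ K (users-↭ (↭-sym G↭))))) atoms
    }
    where open Encodes I

  -- The successor variable is new both to `d` and to the chains, so it can become the top of the
  -- chain of `r` and is itself unconstrained.
  fire-succ : {G : Goal} {K : Store} {d : Builtin} {j j′ : Fin (suc n)} {v : Registers}
    {r : Reg} {j+1<n : suc (toℕ j′) < suc n} (ρ : Var → Var) →
    M j′ ≡ succ r j+1<n →
    ρ (succVar r) ∉ fvBuiltin d →
    (I : Encodes (iAtom j′ (ρ ∘ regVar) ∷ []) ⟨ G , K , d ⟩ (j , v)) →
    ¬ Live (Encodes.vars I) (ρ (succVar r)) →
    ∃[ s ] M ⊢ (j , v) ↝ s × Encodes []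
      ⟨ user s⟨ ρ (regVar r) , ρ (succVar r) ⟩ ∷
        user (iAtom (fromℕ< j+1<n) (ρ ∘ (regVar [ r ≔ succVar r ]))) ∷ G , K , d ⟩ s
  fire-succ {G} {K} {d} {j} {j′} {v} {r} {j+1<n} ρ eq x∉d I x-new
    with match-i {f = ρ ∘ regVar} (Encodes.free I) (Encodes.atoms I)
  ... | refl , heads≃ , rest = (fromℕ< j+1<n , set r (suc (get r v)) v) , succ eq , record
      { vars     = vars [ r ≔ x ∷ vars r ]
      ; distinct = distinct-push r x-new distinct
      ; lengths  = lengths-≔ {X = vars} {v} {x ∷ vars r} r lengths (cong suc (lengths r))
      ; inside   = inside′
      ; pure     = pure
      ; free     = unconstrained-fresh {d} x∉d
          (λ (q , m) → Sum.map proj₁ (q ,_) (stack-push {vars} r q m)) free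
      -- The body lists the new link before the `iₚ` atom, `encoding` after it; `chains-push` then
      -- moves the link into its chain.
      ; atoms    = Homogeneous.trans
          (Homogeneous.swap {y′ = iAtom (fromℕ< j+1<n) (top (vars [ r ≔ x ∷ vars r ]))}
            (λ 𝓜 σ h → cong (λ u → sₚ $ (u ∷ σ x ∷ [])) (heads≃ r 𝓜 σ h))
            (iAtom-≔ {d} {fromℕ< j+1<n} {vars} {x ∷ vars r} ρ {succVar r} r heads≃
              (λ 𝓜 σ h → refl))
            rest)
          (Homogeneous.prep (≋.refl d {iAtom (fromℕ< j+1<n) (top (vars [ r ≔ x ∷ vars r ]))})
            (fromPropositional {d} (chains-push vars r x)))
      }
    where
    open Encodes I
    x = ρ (succVar r)
    B = user s⟨ ρ (regVar r) , x ⟩ ∷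
        user (iAtom (fromℕ< j+1<n) (ρ ∘ (regVar [ r ≔ succVar r ]))) ∷ []

    inside′ : ∀ {y} → Live (vars [ r ≔ x ∷ vars r ]) y → y ∈ V ++ fvConfig ⟨ B ++ G , K , d ⟩
    inside′ (q , m) with stack-push {vars} r q m
    ... | inj₁ (refl , _) = ∈-++⁺ʳ V (there (here refl))
    ... | inj₂ m′ =
      V-⊆ {⟨ G , K , d ⟩} {⟨ B ++ G , K , d ⟩} (body-⊆ {G} {K} {d} B) (inside (q , m′))

  -- The second head atom can only be the top link of the chain of `r`. Its existence makes the
  -- register positive, and its removal is the decrement.
  fire-dec : {G : Goal} {K : Store} {d : Builtin} {j j′ l : Fin (suc n)} {v : Registers}
    {r : Reg} {j+1<n : suc (toℕ j′) < suc n} (ρ : Var → Var) →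
    M j′ ≡ decJump r l j+1<n →
    Encodes (iAtom j′ (ρ ∘ regVar) ∷ s⟨ ρ (preVar r) , ρ (regVar r) ⟩ ∷ [])
      ⟨ G , K , d ⟩ (j , v) →
    ∃[ s ] M ⊢ (j , v) ↝ s × Encodes []
      ⟨ user (iAtom (fromℕ< j+1<n) (ρ ∘ (regVar [ r ≔ preVar r ]))) ∷ G , K , d ⟩ s
  fire-dec {G} {K} {d} {v = v} {r = r} {j+1<n} ρ eq I
    with match-i {f = ρ ∘ regVar} (Encodes.free I) (Encodes.atoms I)
  ... | refl , heads≃ , rest =
      let z , zs , vars≡ , pre≃ , rest′ = match-s r free distinct (heads≃ r) rest in
      (fromℕ< j+1<n , set r (length zs) v) ,
      dec eq (trans (sym (lengths r)) (cong length vars≡)) ,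
      record
      { vars     = vars [ r ≔ zs ]
      ; distinct = distinct-pop r vars≡ distinct
      ; lengths  = lengths-≔ {X = vars} {v} {zs} r lengths refl
      ; inside   = λ (q , m) → V-⊆ {⟨ G , K , d ⟩} {⟨ B ++ G , K , d ⟩} (body-⊆ {G} {K} {d} B)
                     (inside (q , stack-pop {vars} r q vars≡ m))
      ; pure     = pure
      ; free     = λ 𝓜 σ → let τ , h , agree = free 𝓜 σ in
                     τ , h , λ (q , m) → agree (q , stack-pop {vars} r q vars≡ m)
      ; atoms    = Homogeneous.prep
          (iAtom-≔ {d} {fromℕ< j+1<n} {vars} {zs} ρ {preVar r} r heads≃ pre≃) rest′
      }
    where
    open Encodes I
    B = user (iAtom (fromℕ< j+1<n) (ρ ∘ (regVar [ r ≔ preVar r ]))) ∷ []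

  -- By `match-zero` the chain of `r` is empty, so the register is zero. The body restores the
  -- consumed atoms with a new position, hence `rest`, which still contains the `zeroₚ` atom, serves
  -- again.
  fire-jump : {G : Goal} {K : Store} {d : Builtin} {j j′ l : Fin (suc n)} {v : Registers}
    {r : Reg} {j+1<n : suc (toℕ j′) < suc n} (ρ : Var → Var) →
    M j′ ≡ decJump r l j+1<n →
    Encodes (zero⟨ ρ (regVar r) ⟩ ∷ iAtom j′ (ρ ∘ regVar) ∷ []) ⟨ G , K , d ⟩ (j , v) →
    ∃[ s ] M ⊢ (j , v) ↝ s × Encodes []
      ⟨ user (iAtom l (ρ ∘ regVar)) ∷ user zero⟨ ρ (regVar r) ⟩ ∷ G , K , d ⟩ s
  fire-jump {G} {K} {d} {l = l} {r = r} ρ eq I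
    with match-i {f = ρ ∘ regVar} (Encodes.free I)
           (Homogeneous.trans (fromPropositional {d} (_↭_.swap _ _ ↭-refl)) (Encodes.atoms I))
  ... | refl , heads≃ , rest =
      _ , jump eq (trans (sym (lengths r))
                    (cong length (match-zero r free distinct (heads≃ r) rest))) ,
      record
      { vars     = vars
      ; distinct = distinct
      ; lengths  = lengths
      ; inside   = V-⊆ {⟨ G , K , d ⟩} {⟨ B ++ G , K , d ⟩} (body-⊆ {G} {K} {d} B) ∘ inside
      ; pure     = pure
      ; free     = free
      ; atoms    = Homogeneous.prep (iAtom-cong {d} {l} heads≃) rest
      }
    where
    open Encodes I
    B = user (iAtom l (ρ ∘ regVar)) ∷ user zero⟨ ρ (regVar r) ⟩ ∷ []

  simplify-encodes : {G B : Goal} {K K₀ H′ : Store} {d eqs : Builtin} {H : List⁺ (Atom Term)}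
    {C : List Builtin} {s : State (suc n)} →
    K ↭ H′ ++ K₀ →
    FreshVariant ⟦ M ⟧₂ V ⟨ G , K , d ⟩ (simplification H C B) →
    Equations (List⁺.toList H) H′ eqs →
    CT⊨ d ⟶ exs (fvStore (List⁺.toList H)) (eqs ∧ ⋀ C) →
    Encodes [] ⟨ G , K , d ⟩ s →
    ∃[ s′ ] M ⊢ s ↝ s′ × Encodes [] ⟨ B ++ G , K₀ , eqs ∧ d ⟩ s′
  simplify-encodes {G} {B} {K} {K₀} {H′} {d} {eqs} {H} {C} {s} K↭
    ((r , ρ , r∈P , ρ-injective , r′≡) , fresh) E guard I = step (∈⇒InstrRule r∈P) r′≡
    where
    open Encodes I
    W  = V ++ fvConfig ⟨ G , K , d ⟩
    hd = List⁺.toList H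

    d⊆W : ∀ {x} → x ∈ fvBuiltin d → x ∈ W
    d⊆W x∈d = ∈-++⁺ʳ V (∈-++⁺ʳ (fvGoal G) (∈-++⁺ʳ (fvStore K) x∈d))

    H′⊆W : ∀ {x} → x ∈ fvStore H′ → x ∈ W
    H′⊆W x∈H′ = ∈-++⁺ʳ V (∈-++⁺ʳ (fvGoal G) (∈-++⁺ˡ
      (∈-fvStore-resp-↭ (↭-sym K↭) (∈-fvStore-++⁺ˡ H′ K₀ x∈H′))))

    matched : Encodes hd ⟨ G , K₀ , eqs ∧ d ⟩ s
    matched = record
      { vars     = vars
      ; distinct = distinct
      ; lengths  = lengths
      ; inside   = V-⊆ {⟨ G , K , d ⟩} {⟨ G , K₀ , eqs ∧ d ⟩}
                     (simplify-⊆ {G} {d = d} K↭ E) ∘ inside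
      ; pure     = pure
      ; free     = unconstrained-guard {d} {eqs} {⋀ C} {Live vars} {fvStore hd} guard
                     (λ (x∈H , x∈W) → fresh (∈-++⁺ˡ x∈H , x∈W)) inside d⊆W free
      ; atoms    = simplify-↭ K↭ E atoms
      }

    step : InstrRule r → simplification H C B ≡ renRule ρ r →
      ∃[ s′ ] M ⊢ s ↝ s′ × Encodes [] ⟨ B ++ G , K₀ , eqs ∧ d ⟩ s′
    step (dec eq)  refl = fire-dec ρ eq matched
    step (jump eq) refl = fire-jump ρ eq matched
    step (succ {r = q} eq) refl = fire-succ ρ eq x∉D matched (x∉W ∘ inside)
      where
      x = ρ (succVar q)

      x∉W : x ∉ W
      x∉W x∈W = fresh (∈-++⁺ʳ (fvStore hd) (there (here refl)) , x∈W)

      -- Freshness separates the rule from the configuration only. Within the rule it is the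
      -- injectivity of `ρ` that keeps the successor variable apart from the head variables, and so
      -- out of `eqs`.
      x∉H : ∀ q → ρ (succVar q) ∉ fvStore hd
      x∉H r₁ (here eq)         with () ← ρ-injective eq
      x∉H r₁ (there (here eq)) with () ← ρ-injective eq
      x∉H r₂ (here eq)         with () ← ρ-injective eq
      x∉H r₂ (there (here eq)) with () ← ρ-injective eq

      x∉D : x ∉ fvBuiltin (eqs ∧ d)
      x∉D x∈D with ∈-++⁻ (fvBuiltin eqs) x∈D
      ... | inj₂ x∈d = x∉W (d⊆W x∈d)
      ... | inj₁ x∈e with fv-Equations E x∈e
      ...   | inj₁ x∈H  = x∉H q x∈H
      ...   | inj₂ x∈H′ = x∉W (H′⊆W x∈H′)

  -- Runs of the program and runs of the machine.

  infix 3 _⟶ᴹ_ _⟶ᴹ*_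
  _⟶ᴹ_ _⟶ᴹ*_ : Config → Config → Set₁
  _⟶ᴹ_  = ⟦ M ⟧₂ ∣ V ⊢_⟶_
  _⟶ᴹ*_ = Star _⟶ᴹ_

  -- Goals stay free of built-ins, so Solve never fires, and the program has no propagation rules.
  -- Recording that Introduce starts from a nonempty goal makes every step from an empty goal a
  -- machine step.
  step-encodes : {γ γ′ : Config} {s : State (suc n)} → γ ⟶ᴹ γ′ → Encodes [] γ s →
    (∃[ s′ ] M ⊢ s ↝ s′ × Encodes [] γ′ s′) ⊎ (Encodes [] γ′ s × Config.goal γ ≢ [])
  step-encodes (solve {c = c} G↭ _) I =
    ⊥-elim (↭ₚ.¬x∷xs↭[] (subst (c ∷ _ ↭_) (Encodes.pure I) (↭-sym (builtins-↭ G↭))))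
  step-encodes (introduce G↭) I =
    inj₂ (introduce-encodes G↭ I , λ { refl → ↭ₚ.¬x∷xs↭[] (↭-sym G↭) })
  step-encodes (simplify {H = H} {C} K↭ fresh E guard) I =
    inj₁ (simplify-encodes {H = H} {C} K↭ fresh E guard I)
  step-encodes (propagate _ ((_ , ρ , r∈P , _ , r′≡) , _) _ _) I
    with ∈⇒InstrRule r∈P | r′≡
  ... | succ _ | ()
  ... | dec _  | ()
  ... | jump _ | ()

  run-sound : {γ γ′ : Config} {s : State (suc n)} → γ ⟶ᴹ* γ′ → Encodes [] γ s →
    ∃[ s′ ] Star (M ⊢_↝_) s s′ × Encodes [] γ′ s′
  run-sound ε        I = _ , ε , I
  run-sound (t ◅ ts) I with step-encodes t I
  ... | inj₂ (I′ , _) = run-sound ts I′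
  ... | inj₁ (_ , s↝ , I′) with run-sound ts I′
  ...   | s′ , ss , I″ = s′ , s↝ ◅ ss , I″

  -- The substitution handed to `simplify-enabled`: `0` and `1` are the numbers of `R₁` and `R₂`,
  -- and the only other variable in a head is a `preVar`, sent to `p`. For heads without one, `p` is
  -- given the dummy value `0`.
  matching : (Reg → List Var) → Var → Var → Var
  matching X p 0 = top X r₁
  matching X p 1 = top X r₂
  matching X p _ = p

  step-enabled : {K : Store} {d : Builtin} {s s′ : State (suc n)} →
    M ⊢ s ↝ s′ → Encodes [] ⟨ [] , K , d ⟩ s → ∃[ γ ] ⟨ [] , K , d ⟩ ⟶ᴹ γ
  step-enabled {K} {d} {j , v} s↝ I = enabled s↝
    where
    open Encodes I

    satisfiable : Unconstrained d (_∈ [])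
    satisfiable 𝓜 σ = let τ , h , _ = free 𝓜 σ in τ , h , λ ()

    fire : ∀ {H B} θ L → InstrRule (H ⇔ᵣ B) →
      encoding j vars ↭ map (renAtom θ) (List⁺.toList H) ++ L →
      ∃[ γ ] ⟨ [] , K , d ⟩ ⟶ᴹ γ
    fire {H} {B} θ L ι p = simplify-enabled {L = L} {H = H} {B} θ (InstrRule⇒∈ ι) satisfiable
      (Homogeneous.trans atoms (fromPropositional {d} p))

    chain-top : ∀ r {x} xs → vars r ≡ x ∷ xs → top vars r ≡ x
    chain-top r xs eq rewrite eq = refl

    dec-↭ : ∀ r {x xs} → vars r ≡ x ∷ xs → encoding j vars ↭
      map (renAtom (matching vars (topOf (regVar r) xs)))
        (iAtom j regVar ∷ s⟨ preVar r , regVar r ⟩ ∷ []) ++ chains (vars [ r ≔ xs ])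
    dec-↭ r₁ {x} {xs} eq rewrite chain-top r₁ xs eq = _↭_.prep _ (chains-pop {vars} r₁ eq)
    dec-↭ r₂ {x} {xs} eq rewrite chain-top r₂ xs eq = _↭_.prep _ (chains-pop {vars} r₂ eq)

    jump-↭ : ∀ r → vars r ≡ [] → ∃[ L ] encoding j vars ↭
      map (renAtom (matching vars 0)) (zero⟨ regVar r ⟩ ∷ iAtom j regVar ∷ []) ++ L
    jump-↭ r₁ eq rewrite eq = _ , _↭_.swap _ _ ↭-refl
    jump-↭ r₂ eq rewrite eq = _ , ↭-trans
      (_↭_.prep _ (↭ₚ.++-comm (chain R₁ (vars r₁)) _)) (_↭_.swap _ _ ↭-refl)

    enabled : ∀ {s′} → M ⊢ (j , v) ↝ s′ → ∃[ γ ] ⟨ [] , K , d ⟩ ⟶ᴹ γ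
    enabled (succ eq) = fire (matching vars 0) (chains vars) (succ eq) ↭-refl
    enabled (dec {r = r} eq get≡) with vars r in vars≡ | trans (lengths r) get≡
    ... | x ∷ xs | _ = fire (matching vars (topOf (regVar r) xs)) _ (dec eq) (dec-↭ r vars≡)
    enabled (jump {r = r} eq get≡) with vars r in vars≡ | trans (lengths r) get≡
    ... | [] | _ = fire (matching vars 0) _ (jump eq) (proj₂ (jump-↭ r vars≡))

  introduce-all : (G : Goal) {K : Store} {d : Builtin} {s : State (suc n)} →
    Encodes [] ⟨ G , K , d ⟩ s →
    ∃[ K′ ] ⟨ G , K , d ⟩ ⟶ᴹ* ⟨ [] , K′ , d ⟩ × Encodes [] ⟨ [] , K′ , d ⟩ s
  introduce-all []              I = _ , ε , I
  introduce-all (builtin _ ∷ G) I with () ← Encodes.pure I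
  introduce-all (user h ∷ G)    I with introduce-all G (introduce-encodes ↭-refl I)
  ... | K′ , ts , I′ = K′ , introduce ↭-refl ◅ ts , I′

  run-complete : {K : Store} {d : Builtin} {s s′ : State (suc n)} →
    Star (M ⊢_↝_) s s′ → Encodes [] ⟨ [] , K , d ⟩ s →
    ∃[ K′ ] ∃[ d′ ] ⟨ [] , K , d ⟩ ⟶ᴹ* ⟨ [] , K′ , d′ ⟩ × Encodes [] ⟨ [] , K′ , d′ ⟩ s′
  run-complete ε         I = _ , _ , ε , I
  run-complete (s↝ ◅ ss) I with step-enabled s↝ I
  ... | ⟨ G , _ , _ ⟩ , t with step-encodes t I
  ...   | inj₂ (_ , []≢[]) = contradiction refl []≢[]
  -- The step obtained from `step-enabled` comes without information on its target; as it simulates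
  -- some machine step, determinism identifies that step with the given one.
  ...   | inj₁ (_ , s↝′ , I′) with refl ← ↝-deterministic s↝ s↝′ with introduce-all G I′
  ...     | _ , ts , I″ with run-complete ss I″
  ...       | K′ , d′ , ts′ , I‴ = K′ , d′ , t ◅ ts ◅◅ ts′ , I‴

  -- Final configurations and their answers.

  final⇒halt : {K : Store} {d : Builtin} {j : Fin (suc n)} {v : Registers} →
    Final ⟦ M ⟧₂ V ⟨ [] , K , d ⟩ → Encodes [] ⟨ [] , K , d ⟩ (j , v) → M j ≡ halt
  final⇒halt final I = stuck-halt λ s↝ → final (step-enabled s↝ I)

  halt⇒final : {K : Store} {d : Builtin} {j : Fin (suc n)} {v : Registers} →
    M j ≡ halt → Encodes [] ⟨ [] , K , d ⟩ (j , v) → Final ⟦ M ⟧₂ V ⟨ [] , K , d ⟩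
  halt⇒final halts I (_ , t) with step-encodes t I
  ... | inj₁ (_ , s↝ , _) = halt-stuck halts s↝
  ... | inj₂ (_ , []≢[])  = []≢[] refl

  -- In one direction the solution of `d` itself turns `K` into the encoding. In the other, an
  -- arbitrary assignment of the chain variables must extend to a solution of `d` in the same model,
  -- which is what `free` provides.
  answer-≈ : {K : Store} {d : Builtin} {j : Fin (suc n)} {v : Registers} {φ : Goal}
    (I : Encodes [] ⟨ [] , K , d ⟩ (j , v)) →
    builtins φ ≡ [] → users φ ↭ encoding j (Encodes.vars I) →
    (∃₋[ V ] (map user K ++ builtin d ∷ [])) ≈ (∃₋[ R₁ ∷ R₂ ∷ [] ] φ)
  answer-≈ {K} {d} {j} {φ = φ} I φ-pure φ↭ 𝓜 σ N = mk⇔ to from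
    where
    open Encodes I

    users-K : users (map user K ++ builtin d ∷ []) ≡ K
    users-K = trans (users-user K _) (++-identityʳ K)

    builtins-K : builtins (map user K ++ builtin d ∷ []) ≡ d ∷ []
    builtins-K = builtins-user K _

    value* : Valuation 𝓜 → Store → List (Atom (Model.Dom 𝓜))
    value* τ = map (mapAtom (value 𝓜 τ))

    to : Satisfies 𝓜 σ N (∃₋[ V ] (map user K ++ builtin d ∷ [])) →
      Satisfies 𝓜 σ N (∃₋[ R₁ ∷ R₂ ∷ [] ] φ)
    to (τ , agree , hs , p) with subst (All (Holds 𝓜 τ)) builtins-K hs
    ... | h ∷ [] = τ , (λ x x∈ → agree x (∈-++⁺ˡ x∈)) ,
      subst (All (Holds 𝓜 τ)) (sym φ-pure) [] ,
      ↭-trans (↭ₚ.map⁺ _ φ↭) (↭-trans (↭-sym (evaluate 𝓜 τ h atoms))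
        (subst (λ L → value* τ L ↭ N) users-K p))

    from : Satisfies 𝓜 σ N (∃₋[ R₁ ∷ R₂ ∷ [] ] φ) →
      Satisfies 𝓜 σ N (∃₋[ V ] (map user K ++ builtin d ∷ []))
    from (τ , agree , _ , p) with free 𝓜 τ
    ... | τ′ , h , τ′≈τ = τ′ , agree′ ,
      subst (All (Holds 𝓜 τ′)) (sym builtins-K) (h ∷ []) ,
      subst (λ L → value* τ′ L ↭ N) (sym users-K)
        (↭-trans (evaluate 𝓜 τ′ h atoms)
        (↭-trans (↭-reflexive (store-cong 𝓜 (encoding j vars) (τ′≈τ ∘ fv-encoding j vars)))
        (↭-trans (↭ₚ.map⁺ _ (↭-sym φ↭)) p)))
      where
      agree₁ = trans (τ′≈τ (r₁ , here refl)) (agree R₁ (here refl))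
      agree₂ = trans (τ′≈τ (r₂ , here refl)) (agree R₂ (there (here refl)))

      -- `V` lists `R₁` and `R₂` twice, first from the `zeroₚ` atoms and then from the `iₚ` atom.
      agree′ : ∀ x → x ∈ V → τ′ x ≡ σ x
      agree′ x (here refl)                         = agree₁
      agree′ x (there (here refl))                 = agree₂
      agree′ x (there (there (here refl)))         = agree₁
      agree′ x (there (there (there (here refl)))) = agree₂

  module _ {τ τ′ : Valuation generic} (R₁-agree : τ′ R₁ ≡ τ R₁) where

    private
      ground : Valuation generic → Store → List (Atom (Model.Dom generic))
      ground σ = map (mapAtom (value generic σ))

    -- As `τ` separates variables, the link ending in the value of the current top is the same on
    -- both sides. Cancelling it makes the next variables down agree again, so the induction goes
    -- on. Once `xs` is exhausted, `R₁` has the value of the top of `X r₁`, and that chain is empty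
    -- too.
    chain-length : {X : Reg → List Var} {N : List (Atom (Model.Dom generic))} (xs : List Var) →
      Distinct X → Separating X τ → τ′ (topOf R₁ xs) ≡ τ (top X r₁) →
      ground τ′ (chain R₁ xs) ++ N ↭ ground τ (chains X) → length xs ≡ length (X r₁)
    chain-length {X} [] D sep top≡ p = bottom (unique D r₁)
      (separating-injective sep (r₁ , here refl) (top-live X r₁) (trans (sym R₁-agree) top≡))
      where
      open Distinct
      bottom : ∀ {ys} → Unique (R₁ ∷ ys) → R₁ ≡ topOf R₁ ys → 0 ≡ length ys
      bottom {[]}    u _  = refl
      bottom {_ ∷ _} u eq = ⊥-elim (Unique[x∷xs]⇒x∉xs u (here eq))
    chain-length {X} (x ∷ xs) D sep top≡ p
      with find-s {Q = λ a → mapAtom (value generic τ′) s⟨ topOf R₁ xs , x ⟩ ≡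
                              mapAtom (value generic τ) a}
             D r₁ (λ ())
             (λ y∈ eq → separating-injective sep y∈ (top-live X r₁)
               (trans (sym (proj₂ (s-injective eq))) top≡))
             (Anyₚ.map⁻ (↭ₚ.∈-resp-↭ p (here refl)))
    ... | y , ys , vars≡ , eq = trans
      (cong suc (chain-length xs (distinct-pop r₁ vars≡ D)
        (λ (r , m) → sep (r , stack-pop {X} r₁ r vars≡ m))
        (proj₁ (s-injective eq))
        (↭ₚ.drop-∷ (↭-trans p (↭-trans
          (↭ₚ.map⁺ (mapAtom (value generic τ)) (chains-pop {X} r₁ vars≡))
          (↭-reflexive (cong (_∷ ground τ (chains (X [ r₁ ≔ ys ]))) (sym eq))))))))
      (cong length (sym vars≡))

  -- The facts contain only one with predicate `iₚ`. Cancelling it yields the equality of tops with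
  -- which `chain-length` starts.
  answer-length : {K : Store} {d : Builtin} {j j′ : Fin (suc n)} {v : Registers} {φ : Goal}
    {R₂′ : Var} {xs : List Var} {L : Store} →
    Encodes [] ⟨ [] , K , d ⟩ (j , v) →
    users φ ↭ i⟨ j′ , topOf R₁ xs , R₂′ ⟩ ∷ chain R₁ xs ++ L →
    (∃₋[ V ] (map user K ++ builtin d ∷ [])) ≈ (∃₋[ R₁ ∷ R₂ ∷ [] ] φ) →
    length xs ≡ get r₁ v
  answer-length {K} {d} {j} {j′} {v} {φ} {R₂′} {xs} {L} I φ↭ A≈
    with Encodes.free I generic generic-valuation
  ... | τ , h , sep
    -- The equivalence is tested at one point: the model `generic`, a solution `τ` of `d` that
    -- separates the chain variables, and the facts into which `τ` turns `K`.
    with Equivalence.to (A≈ generic τ (map (mapAtom (value generic τ)) K))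
           (τ , (λ _ _ → refl) ,
            subst (All (Holds generic τ)) (sym (builtins-user K _)) (h ∷ []) ,
            ↭-reflexive (cong (map _) (trans (users-user K _) (++-identityʳ K))))
  ... | τ′ , agree , _ , p
    with ↭-trans (↭ₚ.map⁺ (mapAtom (value generic τ′)) (↭-sym φ↭))
           (↭-trans p (evaluate generic τ h (Encodes.atoms I)))
  ... | q = trans (chain-length {τ} {τ′} (agree R₁ (here refl)) xs distinct sep
              (proj₁ (proj₂ (i-injective i≡)))
              (subst (_↭ _) (map-++ _ (chain R₁ xs) L) (↭ₚ.drop-∷ (subst
                (λ a → a ∷ map (mapAtom (value generic τ′)) (chain R₁ xs ++ L) ↭
                  map (mapAtom (value generic τ)) (encoding j vars)) i≡ q))))
            (lengths r₁)
    where
    open Encodes I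
    head-i : ∀ {a : Atom (Model.Dom generic)} → pred a ≡ iₚ →
      a ∈ map (mapAtom (value generic τ)) (encoding j vars) →
      a ≡ mapAtom (value generic τ) (iAtom j (top vars))
    head-i _  (here eq)  = eq
    head-i a≡ (there m) with any-chains vars (Anyₚ.map⁻ m)
    ... | r , m′ with any-chain (vars r) m′
    ...   | inj₁ refl with () ← a≡
    ...   | inj₂ (_ , _ , _ , refl) with () ← a≡

    i≡ = head-i refl (↭ₚ.∈-resp-↭ q (here refl))

  -- Halting and the form of the answers.

  Halts : ℕ → Set
  Halts k = HaltsWithOutput M 0 0 k

  -- Quantifying over `φ` leaves the presentation of the final encoding open, so that one run serves
  -- both forms of the answer.
  halts⇒answer : {k : ℕ} → Halts k →
    ∃[ j ] ∃[ X ] Distinct X × length (X r₁) ≡ k ×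
    ((φ : Goal) → builtins φ ≡ [] → users φ ↭ encoding j X →
      HasQualifiedAnswer ⟦ M ⟧₂ (initialGoal zero) (∃₋[ R₁ ∷ R₂ ∷ [] ] φ))
  halts⇒answer (j , b , ss , halts) with introduce-all (initialGoal zero) initial
  ... | _ , ts , I with run-complete ss I
  ... | K , d , ts′ , I′ = j , vars , distinct , lengths r₁ , λ φ φ-pure φ↭ →
        _ , qa (ts ◅◅ ts′) (halt⇒final halts I′) , answer-≈ {φ = φ} I′ φ-pure φ↭
    where open Encodes I′

  answer⇒halts : {j : Fin (suc n)} {R₂′ : Var} {xs : List Var} {L : Store} (φ : Goal) →
    users φ ↭ i⟨ j , topOf R₁ xs , R₂′ ⟩ ∷ chain R₁ xs ++ L →
    HasQualifiedAnswer ⟦ M ⟧₂ (initialGoal zero) (∃₋[ R₁ ∷ R₂ ∷ [] ] φ) →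
    Halts (length xs)
  answer⇒halts {xs = xs} φ φ↭ (_ , qa ts final , A≈) with run-sound ts initial
  ... | (j , a , b) , ss , I =
    j , b , subst (λ a → Star (M ⊢_↝_) (zero , 0 , 0) (j , a , b)) (sym k≡) ss ,
    final⇒halt final I
    where
    k≡ : length xs ≡ a
    k≡ = answer-length {φ = φ} {xs = xs} I φ↭ A≈

  links : {m : ℕ} → (Fin (suc m) → Var) → Store
  links {m} S = tabulate {n = m} (λ q → s⟨ S (inject₁ q) , S (suc q) ⟩)

  -- Answers number the links from the bottom, whereas `chain` lists them from the top. The
  -- accumulator `xs` of the reversal is the part of the chain already passed.
  chain-ʳ++ : {m : ℕ} (S : Fin (suc m) → Var) (b : Var) (xs : List Var) →
    s⟨ topOf b xs , S zero ⟩ ∷ links S ++ chain b xs ↭ chain b (tabulate S ʳ++ xs)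
  chain-ʳ++ {zero}  S b xs = ↭-refl
  chain-ʳ++ {suc m} S b xs = ↭-trans
    (↭-sym (↭ₚ.shift s⟨ topOf b xs , S zero ⟩
      (s⟨ S zero , S (suc zero) ⟩ ∷ links (S ∘ suc)) (chain b xs)))
    (chain-ʳ++ (S ∘ suc) b (S zero ∷ xs))

  topOf-ʳ++ : {m : ℕ} (S : Fin (suc m) → Var) (b : Var) (xs : List Var) →
    topOf b (tabulate S ʳ++ xs) ≡ S (fromℕ m)
  topOf-ʳ++ {zero}  S b xs = refl
  topOf-ʳ++ {suc m} S b xs = topOf-ʳ++ (S ∘ suc) b (S zero ∷ xs)

  body-answer₊ : {m : ℕ} (j : Fin (suc n)) (R₂′ : Var) (S : Fin (suc m) → Var) (H : Goal) →
    Answer.body (answer₊ j R₂′ S H) ≡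
    map user (i⟨ j , S (fromℕ m) , R₂′ ⟩ ∷ zero⟨ R₁ ⟩ ∷ s⟨ R₁ , S zero ⟩ ∷ links S) ++ H
  body-answer₊ {m} j R₂′ S H = cong
    (λ L → user i⟨ j , S (fromℕ m) , R₂′ ⟩ ∷ user zero⟨ R₁ ⟩ ∷ user s⟨ R₁ , S zero ⟩ ∷ L ++ H)
    (sym (map-tabulate (λ q → s⟨ S (inject₁ q) , S (suc q) ⟩) user))

  users-answer₊ : {m : ℕ} (j : Fin (suc n)) (R₂′ : Var) (S : Fin (suc m) → Var) (H : Goal) →
    users (Answer.body (answer₊ j R₂′ S H)) ↭
    i⟨ j , topOf R₁ (reverse (tabulate S)) , R₂′ ⟩ ∷ chain R₁ (reverse (tabulate S)) ++ users H
  users-answer₊ {m} j R₂′ S H = begin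
    users (Answer.body (answer₊ j R₂′ S H))
      ≡⟨ cong users (body-answer₊ j R₂′ S H) ⟩
    users (map user (i⟨ j , S (fromℕ m) , R₂′ ⟩ ∷ zero⟨ R₁ ⟩ ∷ s⟨ R₁ , S zero ⟩ ∷ links S) ++ H)
      ≡⟨ users-user (i⟨ j , S (fromℕ m) , R₂′ ⟩ ∷ zero⟨ R₁ ⟩ ∷ s⟨ R₁ , S zero ⟩ ∷ links S) H ⟩
    i⟨ j , S (fromℕ m) , R₂′ ⟩ ∷ zero⟨ R₁ ⟩ ∷ s⟨ R₁ , S zero ⟩ ∷ links S ++ users H
      ↭⟨ _↭_.prep _ (↭ₚ.++⁺ʳ (users H) (↭-trans
           (↭ₚ.∷↭∷ʳ zero⟨ R₁ ⟩ (s⟨ R₁ , S zero ⟩ ∷ links S)) (chain-ʳ++ S R₁ []))) ⟩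
    i⟨ j , S (fromℕ m) , R₂′ ⟩ ∷ chain R₁ (reverse (tabulate S)) ++ users H
      ≡⟨ cong (λ x → i⟨ j , x , R₂′ ⟩ ∷ chain R₁ (reverse (tabulate S)) ++ users H)
           (topOf-ʳ++ S R₁ []) ⟨
    i⟨ j , topOf R₁ (reverse (tabulate S)) , R₂′ ⟩ ∷ chain R₁ (reverse (tabulate S)) ++ users H
      ∎
    where open PermutationReasoning

  builtins-answer₊ : {m : ℕ} (j : Fin (suc n)) (R₂′ : Var) (S : Fin (suc m) → Var) (K : Store) →
    builtins (Answer.body (answer₊ j R₂′ S (map user K))) ≡ []
  builtins-answer₊ {m} j R₂′ S K = trans (cong builtins (body-answer₊ j R₂′ S (map user K)))
    (trans (builtins-user (i⟨ j , S (fromℕ m) , R₂′ ⟩ ∷ zero⟨ R₁ ⟩ ∷ s⟨ R₁ , S zero ⟩ ∷ links S)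
             (map user K))
           (builtins-map-user K))

theorem3p3 : (n e : ℕ) (M : Machine (suc n)) →
    let open Encoding (suc n) e in
    ((m : ℕ) →
    HaltsWithOutput M 0 0 (suc m) ⇔
    (Σ[ j ∈ Fin (suc n) ] Σ[ R₂′ ∈ Var ] Σ[ S ∈ (Fin (suc m) → Var) ] Σ[ H ∈ Goal ]
    Unique (R₁ ∷ R₂ ∷ tabulate S) ×
    Disjoint (fvGoal H) (R₁ ∷ tabulate S) ×
    HasQualifiedAnswer ⟦ M ⟧₂ (initialGoal zero) (answer₊ j R₂′ S H)))
    ×
    (HaltsWithOutput M 0 0 0 ⇔
    (Σ[ j ∈ Fin (suc n) ] Σ[ R₂′ ∈ Var ] Σ[ H ∈ Goal ]
    Disjoint (fvGoal H) (R₁ ∷ []) ×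
    HasQualifiedAnswer ⟦ M ⟧₂ (initialGoal zero) (answer₀ j R₂′ H)))
theorem3p3 n e M = (λ m → mk⇔ (to₊ m) (from₊ m)) , mk⇔ to₀ from₀
  where
  open Encoding (suc n) e
  open CHRProperties (Fin (suc n) ⊎ Fin e) TCMPred tcmArity
  open Simulation n e M

  -- The chain of the second register plays the part of `H`; `separate` forbids it to share a
  -- variable with the first.
  disjoint : {X : Reg → List Var} {ys : List Var} → Distinct X →
    (∀ {x} → x ∈ ys → x ∈ stack X r₁) → Disjoint (fvGoal (map user (chain R₂ (X r₂)))) ys
  disjoint {X} D ys⊆ (x∈H , x∈ys)
    with () ← Distinct.separate D (ys⊆ x∈ys)
                (fv-chain R₂ (X r₂) (subst (_ ∈_) (fvGoal-user (chain R₂ (X r₂))) x∈H))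

  to₀ : Halts 0 → Σ[ j ∈ Fin (suc n) ] Σ[ R₂′ ∈ Var ] Σ[ H ∈ Goal ]
    Disjoint (fvGoal H) (R₁ ∷ []) ×
    HasQualifiedAnswer ⟦ M ⟧₂ (initialGoal zero) (answer₀ j R₂′ H)
  to₀ h with halts⇒answer h
  ... | j , X , D , len , answer = j , top X r₂ , map user (chain R₂ (X r₂)) ,
    disjoint D (λ { (here refl) → here refl }) ,
    answer (Answer.body (answer₀ j (top X r₂) (map user (chain R₂ (X r₂)))))
      (builtins-map-user (chain R₂ (X r₂))) (↭-reflexive (users≡ (X r₁) len))
    where
    users≡ : ∀ xs → length xs ≡ 0 →
      i⟨ j , R₁ , top X r₂ ⟩ ∷ zero⟨ R₁ ⟩ ∷ users (map user (chain R₂ (X r₂))) ≡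
      i⟨ j , topOf R₁ xs , top X r₂ ⟩ ∷ chain R₁ xs ++ chain R₂ (X r₂)
    users≡ [] refl = cong (λ L → i⟨ j , R₁ , top X r₂ ⟩ ∷ zero⟨ R₁ ⟩ ∷ L)
      (users-map-user (chain R₂ (X r₂)))

  from₀ : (Σ[ j ∈ Fin (suc n) ] Σ[ R₂′ ∈ Var ] Σ[ H ∈ Goal ]
    Disjoint (fvGoal H) (R₁ ∷ []) ×
    HasQualifiedAnswer ⟦ M ⟧₂ (initialGoal zero) (answer₀ j R₂′ H)) → Halts 0
  from₀ (j , R₂′ , H , _ , answer) =
    answer⇒halts {j} {R₂′} {[]} (Answer.body (answer₀ j R₂′ H)) ↭-refl answer

  to₊ : ∀ m → Halts (suc m) →
    Σ[ j ∈ Fin (suc n) ] Σ[ R₂′ ∈ Var ] Σ[ S ∈ (Fin (suc m) → Var) ] Σ[ H ∈ Goal ]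
    Unique (R₁ ∷ R₂ ∷ tabulate S) ×
    Disjoint (fvGoal H) (R₁ ∷ tabulate S) ×
    HasQualifiedAnswer ⟦ M ⟧₂ (initialGoal zero) (answer₊ j R₂′ S H)
  to₊ m h with halts⇒answer h
  ... | j , X , D , len , answer
    -- The variables are enumerated from the bottom up, hence the reversal.
    with tabulate-surjective (reverse (X r₁)) (trans (length-reverse (X r₁)) len)
  ... | S , S≡ = j , top X r₂ , S , map user (chain R₂ (X r₂)) ,
    subst (λ ys → Unique (R₁ ∷ R₂ ∷ ys)) (sym S≡)
      (SetoidPermutationProperties.Unique-resp-↭ (≡.setoid ℕ)
        (↭⇒↭ₛ (_↭_.prep _ (_↭_.prep _ (↭-sym (↭ₚ.↭-reverse (X r₁))))))
        -- `R₂`, the bottom of the other chain, is inserted behind `R₁` as if it were a new top.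
        (unique-push (λ m → contradiction (Distinct.separate D m (here refl)) λ ())
          (Distinct.unique D r₁))) ,
    disjoint D (λ { (here eq) → here eq ; (there y∈) → there
      (↭ₚ.∈-resp-↭ (↭ₚ.↭-reverse (X r₁)) (subst (_ ∈_) S≡ y∈)) }) ,
    answer (Answer.body (answer₊ j (top X r₂) S (map user (chain R₂ (X r₂)))))
      (builtins-answer₊ j (top X r₂) S (chain R₂ (X r₂)))
      (subst₂ (λ xs L →
                users (Answer.body (answer₊ j (top X r₂) S (map user (chain R₂ (X r₂))))) ↭
                i⟨ j , topOf R₁ xs , top X r₂ ⟩ ∷ chain R₁ xs ++ L)
        (trans (cong reverse S≡) (reverse-involutive (X r₁)))
        (users-map-user (chain R₂ (X r₂)))
        (users-answer₊ j (top X r₂) S (map user (chain R₂ (X r₂)))))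

  from₊ : ∀ m → (Σ[ j ∈ Fin (suc n) ] Σ[ R₂′ ∈ Var ] Σ[ S ∈ (Fin (suc m) → Var) ] Σ[ H ∈ Goal ]
    Unique (R₁ ∷ R₂ ∷ tabulate S) ×
    Disjoint (fvGoal H) (R₁ ∷ tabulate S) ×
    HasQualifiedAnswer ⟦ M ⟧₂ (initialGoal zero) (answer₊ j R₂′ S H)) → Halts (suc m)
  from₊ m (j , R₂′ , S , H , _ , _ , answer) =
    subst Halts (trans (length-reverse (tabulate S)) (length-tabulate S))
      (answer⇒halts {j} {R₂′} {reverse (tabulate S)} (Answer.body (answer₊ j R₂′ S H))
        (users-answer₊ j R₂′ S H) answer)
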